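{- Let $k \leq n$ be positive integers. The set $\mathcal{GS}_{n,k}$ of $(n,k)$-Garsia–Stanton monomials descends to a vector space basis of $R_{n,k}$.
   Context: For positive integers $k \le n$, $I_{n,k} \subseteq \mathbb{Q}[x_1,\dots,x_n]$ is the ideal $\langle x_1^k, \dots, x_n^k, e_n, e_{n-1}, \dots, e_{n-k+1}\rangle$, where $e_d = e_d(x_1,\dots,x_n)$ is the elementary symmetric polynomial of degree $d$, and $R_{n,k} := \mathbb{Q}[x_1,\dots,x_n]/I_{n,k}$. For a permutation $\pi = \pi_1\cdots\pi_n \in \mathfrak{S}_n$, $\mathrm{Des}(\pi) = \{1\le i\le n-1 : \pi_i>\pi_{i+1}\}$, $\mathrm{des}(\pi) = |\mathrm{Des}(\pi)|$, and the Garsia–Stanton monomial is $gs_\pi := \prod_{i \in \mathrm{Des}(\pi)} x_{\pi_1}x_{\pi_2}\cdots x_{\pi_i}$. The $(n,k)$-Garsia–Stanton monomials are $$\mathcal{GS}_{n,k} := \{ gs_\pi \cdot x_{\pi_1}^{i_1}x_{\pi_2}^{i_2}\cdots x_{\pi_{n-k}}^{i_{n-k}} : \pi \in \mathfrak{S}_n,\ \mathrm{des}(\pi)<k,\ (k-\mathrm{des}(\pi)) > i_1 \ge i_2 \ge \cdots \ge i_{n-k} \ge 0\}.$$ -}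

module Defs where

open import Algebra.Bundles using (Ring)
open import Algebra.Module.Bundles using (LeftModule)
open import Data.Bool.Base using (if_then_else_)
open import Data.Fin.Base as Fin using (Fin; toℕ; inject≤)
open import Data.Fin.Permutation using (Permutation′; _⟨$⟩ʳ_)
open import Data.Fin.Properties as Finₚ using (any?)
open import Data.Fin.Subset using (Subset; inside; outside; ∣_∣)
open import Data.List.Base as List
  using (List; []; _∷_; _++_; allFin; cartesianProductWith; filter; foldr; length)
open import Data.List.Relation.Unary.All using (All)
open import Data.List.Relation.Unary.Unique.Propositional using (Unique)
open import Data.Nat.Base as ℕ using (ℕ; zero; suc; _∸_; _≤_; _<_)
import Data.Nat.Properties as ℕₚ
open import Data.Product.Base using (_×_; _,_; ∃; proj₁; proj₂)
open import Data.Rational.Base using (ℚ; 0ℚ; 1ℚ; _+_; _*_; -_)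
import Data.Rational.Properties as ℚₚ
open import Data.Rational.Solver using (module +-*-Solver)
open import Data.Vec.Base as Vec using (Vec; []; _∷_; replicate; zipWith; _[_]≔_)
import Data.Vec.Properties as Vecₚ
open import Function.Base using (_∘_)
open import Level using (Level; 0ℓ; _⊔_)
open import Relation.Binary.PropositionalEquality
  using (_≡_; refl; sym; trans; cong; cong₂)
open import Relation.Nullary.Decidable using (Dec; yes; no; does; _×-dec_)
open import Relation.Unary using (Pred; _∈_)

private
  variable
    n : ℕ

-- The family v restricted to P is a basis of M. A finite linear combination
-- is a list of pairs (coefficient , index); for linear independence the
-- indices occurring in it have to be pairwise distinct.

module _ {r ℓr m ℓm a p : Level} {R : Ring r ℓr} (M : LeftModule R m ℓm)
         {A : Set a} (P : Pred A p) (v : A → LeftModule.Carrierᴹ M) where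

  open LeftModule M
  open Ring R using (Carrier; _≈_; 0#)

  linearCombination : List (Carrier × A) → Carrierᴹ
  linearCombination = foldr (λ (c , i) s → (c *ₗ v i) +ᴹ s) 0ᴹ

  LinearlyIndependent : Set (r ⊔ ℓr ⊔ ℓm ⊔ a ⊔ p)
  LinearlyIndependent =
    (ts : List (Carrier × A)) →
    All (P ∘ proj₂) ts →
    Unique (List.map proj₂ ts) →
    linearCombination ts ≈ᴹ 0ᴹ →
    All (λ (c , _) → c ≈ 0#) ts

  Spanning : Set (r ⊔ m ⊔ ℓm ⊔ a ⊔ p)
  Spanning =
    (x : Carrierᴹ) → ∃ λ (ts : List (Carrier × A)) →
    All (P ∘ proj₂) ts × linearCombination ts ≈ᴹ x

  IsBasis : Set (r ⊔ ℓr ⊔ m ⊔ ℓm ⊔ a ⊔ p)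
  IsBasis = LinearlyIndependent × Spanning

-- Monomials are exponent vectors, so 1ᵐ, _·_ and _^_ act additively.

Monomial : ℕ → Set
Monomial n = Vec ℕ n

infixl 7 _·_
infixr 8 _^_

1ᵐ : Monomial n
1ᵐ = replicate _ 0

_·_ : Monomial n → Monomial n → Monomial n
_·_ = zipWith ℕ._+_

x : Fin n → Monomial n
x i = 1ᵐ [ i ]≔ 1

_^_ : Monomial n → ℕ → Monomial n
u ^ e = Vec.map (e ℕ.*_) u

∏ : {A : Set} → List A → (A → Monomial n) → Monomial n
∏ is f = foldr (λ i u → f i · u) 1ᵐ is

-- A polynomial is a formal sum of terms, in which a monomial may occur
-- repeatedly or with coefficient 0; equality _≈ₚ_ compares coefficients.

Polynomial : ℕ → Set
Polynomial n = List (ℚ × Monomial n)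

coeff : Polynomial n → Monomial n → ℚ
coeff []            u = 0ℚ
coeff ((c , w) ∷ f) u =
  (if does (Vecₚ.≡-dec ℕₚ._≟_ w u) then c else 0ℚ) + coeff f u

infix  4 _≈ₚ_
infixl 6 _+ₚ_
infixl 7 _*ₚ_ _•_

_≈ₚ_ : Polynomial n → Polynomial n → Set
f ≈ₚ g = ∀ u → coeff f u ≡ coeff g u

0ₚ : Polynomial n
0ₚ = []

_+ₚ_ : Polynomial n → Polynomial n → Polynomial n
_+ₚ_ = _++_

_*ₚ_ : Polynomial n → Polynomial n → Polynomial n
_*ₚ_ = cartesianProductWith (λ (c , u) (d , w) → c * d , u · w)

_•_ : ℚ → Polynomial n → Polynomial n
c • f = List.map (λ (d , u) → c * d , u) f

-ₚ_ : Polynomial n → Polynomial n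
-ₚ f = (- 1ℚ) • f

monomial : Monomial n → Polynomial n
monomial u = (1ℚ , u) ∷ []

subsets : ∀ n → List (Subset n)
subsets zero    = [] ∷ []
subsets (suc n) =
  List.map (outside ∷_) (subsets n) ++ List.map (inside ∷_) (subsets n)

squarefree : Subset n → Monomial n
squarefree = Vec.map (λ b → if b then 1 else 0)

elementary : ∀ n → ℕ → Polynomial n
elementary n d =
  List.map (λ s → 1ℚ , squarefree s) (filter (λ s → ∣ s ∣ ℕₚ.≟ d) (subsets n))

data ⟨_⟩ (G : Pred (Polynomial n) 0ℓ) : Pred (Polynomial n) 0ℓ where
  generator : ∀ {f} → f ∈ G → f ∈ ⟨ G ⟩
  zero      : 0ₚ ∈ ⟨ G ⟩
  add       : ∀ {f g} → f ∈ ⟨ G ⟩ → g ∈ ⟨ G ⟩ → f +ₚ g ∈ ⟨ G ⟩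
  multiply  : ∀ h {f} → f ∈ ⟨ G ⟩ → h *ₚ f ∈ ⟨ G ⟩
  respects  : ∀ {f g} → f ≈ₚ g → f ∈ ⟨ G ⟩ → g ∈ ⟨ G ⟩

coeff-+ : (f g : Polynomial n) → ∀ u → coeff (f +ₚ g) u ≡ coeff f u + coeff g u
coeff-+ []            g u = sym (ℚₚ.+-identityˡ _)
coeff-+ ((c , w) ∷ f) g u =
  trans (cong (a +_) (coeff-+ f g u)) (sym (ℚₚ.+-assoc a (coeff f u) (coeff g u)))
  where a = if does (Vecₚ.≡-dec ℕₚ._≟_ w u) then c else 0ℚ

coeff-• : ∀ c (f : Polynomial n) u → coeff (c • f) u ≡ c * coeff f u
coeff-• c []            u = sym (ℚₚ.*-zeroʳ c)
coeff-• c ((d , w) ∷ f) u with Vecₚ.≡-dec ℕₚ._≟_ w u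
... | yes _ = trans (cong (c * d +_) (coeff-• c f u)) (sym (ℚₚ.*-distribˡ-+ c d _))
... | no  _ = trans (cong₂ _+_ (sym (ℚₚ.*-zeroʳ c)) (coeff-• c f u))
                    (sym (ℚₚ.*-distribˡ-+ c 0ℚ _))

coeff-- : (f g : Polynomial n) → ∀ u →
          coeff (f +ₚ -ₚ g) u ≡ coeff f u + - 1ℚ * coeff g u
coeff-- f g u = trans (coeff-+ f (-ₚ g) u) (cong (coeff f u +_) (coeff-• (- 1ℚ) g u))

1ᵐ-identityˡ : (u : Monomial n) → 1ᵐ · u ≡ u
1ᵐ-identityˡ = Vecₚ.zipWith-identityˡ ℕₚ.+-identityˡ

constant-* : ∀ c (f : Polynomial n) → ((c , 1ᵐ) ∷ []) *ₚ f ≡ c • f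
constant-* c []            = refl
constant-* c ((d , w) ∷ f) = cong₂ (λ w f → (c * d , w) ∷ f) (1ᵐ-identityˡ w) (constant-* c f)

-- Two polynomials are equal in the quotient when they differ by an element of
-- the ideal.

module Quotient (G : Pred (Polynomial n) 0ℓ) where

  infix 4 _≈_

  _≈_ : Polynomial n → Polynomial n → Set
  f ≈ g = f +ₚ -ₚ g ∈ ⟨ G ⟩

  scale : ∀ c {f} → f ∈ ⟨ G ⟩ → c • f ∈ ⟨ G ⟩
  scale c {f} f∈ = respects (λ u → cong (λ g → coeff g u) (constant-* c f))
                            (multiply ((c , 1ᵐ) ∷ []) f∈)

  ≈ₚ⇒≈ : ∀ f g → f ≈ₚ g → f ≈ g
  ≈ₚ⇒≈ f g f≈g = respects (λ u → sym (trans (coeff-- f g u)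
    (trans (cong (_+ _) (f≈g u))
           (solve 1 (λ a → a :+ con (- 1ℚ) :* a := con 0ℚ) refl (coeff g u)))))
    zero
    where open +-*-Solver

  ≈-sym : ∀ {f g} → f ≈ g → g ≈ f
  ≈-sym {f} {g} p = respects
    (λ u → trans (coeff-• (- 1ℚ) (f +ₚ -ₚ g) u)
      (trans (cong (- 1ℚ *_) (coeff-- f g u))
      (trans (solve 2 (λ a b → con (- 1ℚ) :* (a :+ con (- 1ℚ) :* b) := b :+ con (- 1ℚ) :* a)
                      refl (coeff f u) (coeff g u))
      (sym (coeff-- g f u)))))
    (scale (- 1ℚ) p)
    where open +-*-Solver

  ≈-trans : ∀ {f g h} → f ≈ g → g ≈ h → f ≈ h
  ≈-trans {f} {g} {h} p q = respects
    (λ u → trans (coeff-+ (f +ₚ -ₚ g) (g +ₚ -ₚ h) u)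
      (trans (cong₂ _+_ (coeff-- f g u) (coeff-- g h u))
      (trans (solve 3 (λ a b c → (a :+ con (- 1ℚ) :* b) :+ (b :+ con (- 1ℚ) :* c)
                                 := a :+ con (- 1ℚ) :* c)
                      refl (coeff f u) (coeff g u) (coeff h u))
      (sym (coeff-- f h u)))))
    (add p q)
    where open +-*-Solver

  +-cong : ∀ {f f′ g g′} → f ≈ f′ → g ≈ g′ → f +ₚ g ≈ f′ +ₚ g′
  +-cong {f} {f′} {g} {g′} p q = respects
    (λ u → trans (coeff-+ (f +ₚ -ₚ f′) (g +ₚ -ₚ g′) u)
      (trans (cong₂ _+_ (coeff-- f f′ u) (coeff-- g g′ u))
      (trans (solve 4 (λ a b c d → (a :+ con (- 1ℚ) :* b) :+ (c :+ con (- 1ℚ) :* d)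
                                   := (a :+ c) :+ con (- 1ℚ) :* (b :+ d))
                      refl (coeff f u) (coeff f′ u) (coeff g u) (coeff g′ u))
      (sym (trans (coeff-- (f +ₚ g) (f′ +ₚ g′) u)
        (cong₂ (λ a b → a + - 1ℚ * b) (coeff-+ f g u) (coeff-+ f′ g′ u)))))))
    (add p q)
    where open +-*-Solver

  •-cong : ∀ c {f g} → f ≈ g → c • f ≈ c • g
  •-cong c {f} {g} p = respects
    (λ u → trans (coeff-• c (f +ₚ -ₚ g) u)
      (trans (cong (c *_) (coeff-- f g u))
      (trans (solve 3 (λ c a b → c :* (a :+ con (- 1ℚ) :* b)
                                 := c :* a :+ con (- 1ℚ) :* (c :* b))
                      refl c (coeff f u) (coeff g u))
      (sym (trans (coeff-- (c • f) (c • g) u)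
        (cong₂ (λ a b → a + - 1ℚ * b) (coeff-• c f u) (coeff-• c g u)))))))
    (scale c p)
    where open +-*-Solver

  +-identityʳ : ∀ f → f +ₚ 0ₚ ≈ f
  +-identityʳ f = ≈ₚ⇒≈ (f +ₚ 0ₚ) f
    (λ u → trans (coeff-+ f 0ₚ u) (ℚₚ.+-identityʳ (coeff f u)))

  +-comm : ∀ f g → f +ₚ g ≈ g +ₚ f
  +-comm f g = ≈ₚ⇒≈ (f +ₚ g) (g +ₚ f)
    (λ u → trans (coeff-+ f g u) (trans (ℚₚ.+-comm (coeff f u) _) (sym (coeff-+ g f u))))

  +-assoc : ∀ f g h → (f +ₚ g) +ₚ h ≈ f +ₚ (g +ₚ h)
  +-assoc f g h = ≈ₚ⇒≈ ((f +ₚ g) +ₚ h) (f +ₚ (g +ₚ h))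
    (λ u → trans (coeff-+ (f +ₚ g) h u)
      (trans (cong (_+ coeff h u) (coeff-+ f g u))
      (trans (ℚₚ.+-assoc (coeff f u) _ _)
      (sym (trans (coeff-+ f (g +ₚ h) u) (cong (coeff f u +_) (coeff-+ g h u)))))))

  -‿inverseʳ : ∀ f → f +ₚ -ₚ f ≈ 0ₚ
  -‿inverseʳ f = respects
    (λ u → sym (trans (coeff-+ (f +ₚ -ₚ f) 0ₚ u) (ℚₚ.+-identityʳ _)))
    (≈ₚ⇒≈ f f (λ _ → refl))

  •-zeroˡ : ∀ f → 0ℚ • f ≈ 0ₚ
  •-zeroˡ f = ≈ₚ⇒≈ (0ℚ • f) 0ₚ (λ u → trans (coeff-• 0ℚ f u) (ℚₚ.*-zeroˡ (coeff f u)))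

  •-distribʳ : ∀ f c d → (c + d) • f ≈ c • f +ₚ d • f
  •-distribʳ f c d = ≈ₚ⇒≈ ((c + d) • f) (c • f +ₚ d • f)
    (λ u → trans (coeff-• (c + d) f u)
      (trans (ℚₚ.*-distribʳ-+ (coeff f u) c d)
      (sym (trans (coeff-+ (c • f) (d • f) u) (cong₂ _+_ (coeff-• c f u) (coeff-• d f u))))))

  •-distribˡ : ∀ c f g → c • (f +ₚ g) ≈ c • f +ₚ c • g
  •-distribˡ c f g = ≈ₚ⇒≈ (c • (f +ₚ g)) (c • f +ₚ c • g)
    (λ u → trans (coeff-• c (f +ₚ g) u)
      (trans (cong (c *_) (coeff-+ f g u))
      (trans (ℚₚ.*-distribˡ-+ c _ _)
      (sym (trans (coeff-+ (c • f) (c • g) u) (cong₂ _+_ (coeff-• c f u) (coeff-• c g u)))))))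

  •-identityˡ : ∀ f → 1ℚ • f ≈ f
  •-identityˡ f = ≈ₚ⇒≈ (1ℚ • f) f (λ u → trans (coeff-• 1ℚ f u) (ℚₚ.*-identityˡ _))

  •-assoc : ∀ c d f → (c * d) • f ≈ c • (d • f)
  •-assoc c d f = ≈ₚ⇒≈ ((c * d) • f) (c • (d • f))
    (λ u → trans (coeff-• (c * d) f u)
      (trans (ℚₚ.*-assoc c d _)
      (sym (trans (coeff-• c (d • f) u) (cong (c *_) (coeff-• d f u))))))

  vectorSpace : LeftModule ℚₚ.+-*-ring 0ℓ 0ℓ
  vectorSpace = record
    { Carrierᴹ = Polynomial n
    ; _≈ᴹ_     = _≈_
    ; _+ᴹ_     = _+ₚ_
    ; _*ₗ_     = _•_
    ; 0ᴹ       = 0ₚ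
    ; -ᴹ_      = -ₚ_
    ; isLeftModule = record
      { isLeftSemimodule = record
        { +ᴹ-isCommutativeMonoid = record
          { isMonoid = record
            { isSemigroup = record
              { isMagma = record
                { isEquivalence = record
                  { refl  = λ {f} → ≈ₚ⇒≈ f f (λ _ → refl)
                  ; sym   = λ {f} {g} → ≈-sym {f} {g}
                  ; trans = λ {f} {g} {h} → ≈-trans {f} {g} {h}
                  }
                ; ∙-cong = λ {f} {f′} {g} {g′} → +-cong {f} {f′} {g} {g′}
                }
              ; assoc = +-assoc
              }
            ; identity = (λ f → ≈ₚ⇒≈ f f (λ _ → refl)) , +-identityʳ
            }
          ; comm = +-comm
          }
        ; isPreleftSemimodule = record
          { *ₗ-cong      = λ { {c} {_} {f} {g} refl p → •-cong c {f} {g} p }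
          ; *ₗ-zeroˡ     = •-zeroˡ
          ; *ₗ-distribʳ  = •-distribʳ
          ; *ₗ-identityˡ = •-identityˡ
          ; *ₗ-assoc     = •-assoc
          ; *ₗ-zeroʳ     = λ _ → zero
          ; *ₗ-distribˡ  = •-distribˡ
          }
        }
      ; -ᴹ‿cong = λ {f} {g} → •-cong (- 1ℚ) {f} {g}
      ; -ᴹ‿inverse =
          (λ f → ≈-trans {(-ₚ f) +ₚ f} {f +ₚ -ₚ f} {0ₚ} (+-comm (-ₚ f) f) (-‿inverseʳ f))
        , -‿inverseʳ
      }
    }

data Generator (n k : ℕ) : Pred (Polynomial n) 0ℓ where
  power : ∀ i → Generator n k (monomial (x i ^ k))
  elem  : ∀ d → suc (n ∸ k) ≤ d → d ≤ n → Generator n k (elementary n d)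

I : ∀ n k → Pred (Polynomial n) 0ℓ
I n k = ⟨ Generator n k ⟩

R : ∀ n k → LeftModule ℚₚ.+-*-ring 0ℓ 0ℓ
R n k = Quotient.vectorSpace (Generator n k)

-- π is read as the word π₁ ⋯ πₙ with πᵢ = π ⟨$⟩ʳ i. Positions are elements
-- of Fin n, so they are numbered from 0.

module _ (π : Permutation′ n) where

  -- i is a descent when it has a successor position j with π_j < π_i; gs then
  -- contributes the product over all positions up to and including i.

  IsDescent : Pred (Fin n) 0ℓ
  IsDescent i = ∃ λ j → toℕ j ≡ suc (toℕ i) × π ⟨$⟩ʳ j Fin.< π ⟨$⟩ʳ i

  isDescent? : ∀ i → Dec (IsDescent i)
  isDescent? i =
    any? λ j → (toℕ j ℕₚ.≟ suc (toℕ i)) ×-dec (π ⟨$⟩ʳ j Finₚ.<? π ⟨$⟩ʳ i)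

  Des : List (Fin n)
  Des = filter isDescent? (allFin n)

  des : ℕ
  des = length Des

  gs : Monomial n
  gs = ∏ Des λ i → ∏ (filter (Finₚ._≤? i) (allFin n)) λ j → x (π ⟨$⟩ʳ j)

-- The chain k - des π > i₁ ≥ ⋯ ≥ i_{n-k} ≥ 0 is split into a bound on every
-- entry and monotonicity; it is vacuous for n = k.

GS : ∀ n k → Pred (Monomial n) 0ℓ
GS n k u =
  ∃ λ (π : Permutation′ n) → des π < k ×
  ∃ λ (i : Fin (n ∸ k) → ℕ) →
    (∀ a → i a < k ∸ des π) ×
    (∀ {a b} → a Fin.≤ b → i b ≤ i a) ×
    u ≡ gs π · ∏ (allFin (n ∸ k)) λ a → x (π ⟨$⟩ʳ inject≤ a (ℕₚ.m∸n≤m n k)) ^ i a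

{-# OPTIONS --safe #-}

-- Rank monomials so that xᵇ e_d has a unique monomial of largest rank: xᵇ times
-- the d letters with the largest exponents in b (smaller letters first in case
-- of a tie). Two products xᵇ e_d and xᶜ e_d′ with the same leading monomial both
-- occur in the expansion of some xᵃ e_d e_d′, whose other products have smaller
-- leading monomials. So one such product for each possible leading monomial
-- suffices to span the ideal E = ⟨ e_d ∣ n - k < d ≤ n ⟩.
--
-- Suppose that xᵢᵏ divides the leading monomial of xᵇ e_d. The terms of xᵇ e_d
-- that are not divisible by xᵢᵏ add up to an element of E of smaller rank,
-- because xᵢ^{k-1} e_d(x̂ᵢ) ∈ E, where x̂ᵢ omits xᵢ. Hence I is spanned by a
-- family with distinct leading monomials, which are those of E together with
-- the multiples of some xᵢᵏ. The remaining monomials are the Garsia–Stanton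
-- monomials, and triangularity makes them a basis of the quotient.

module Submission where

import Data.Nat.Properties
open import Algebra.Properties.CommutativeMonoid.Sum
  Data.Nat.Properties.+-0-commutativeMonoid
  using (sum; sum-cong-≗; ∑-distrib-+; sum-permute)
open import Algebra.Properties.Semiring.Sum Data.Nat.Properties.+-*-semiring
  using (*-distribʳ-sum)
open import Data.Bool.Base using (Bool; true; false; if_then_else_; _∧_)
import Data.Bool.Properties as Boolₚ
open import Data.Fin.Base as Fin
  using (Fin; zero; suc; toℕ; opposite; fromℕ<; inject≤; punchOut)
open import Data.Fin.Induction using (>-wellFounded)
open import Data.Fin.Permutation
  using (Permutation′; permutation; _⟨$⟩ʳ_; _⟨$⟩ˡ_; inverseʳ)
import Data.Fin.Properties as Finₚ
open import Data.Fin.Subset using (Subset; ∣_∣)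
import Data.Fin.Subset.Properties as Subsetₚ
open import Data.List.Base as List
  using (List; []; _∷_; _++_; foldr; filter; length; allFin)
open import Data.List.Membership.Propositional using () renaming (_∈_ to _∈ˡ_)
import Data.List.Membership.Propositional.Properties as ∈ₚ
import Data.List.Properties as Listₚ
open import Data.List.Relation.Unary.All as All using (All; []; _∷_)
import Data.List.Relation.Unary.All.Properties as Allₚ
open import Data.List.Relation.Unary.AllPairs using ([]; _∷_)
open import Data.List.Relation.Unary.Any using (here; there)
open import Data.List.Relation.Unary.Unique.Propositional using (Unique)
import Data.List.Relation.Unary.Unique.Propositional.Properties as Uniqueₚ
open import Data.Nat using (ℕ; _≤_)
open import Data.Nat.Base hiding (_^_)
open import Data.Nat.Induction using (<-wellFounded)
open import Data.Nat.Properties as ℕₚ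
open import Data.Nat.Tactic.RingSolver using (solve-∀)
open import Data.Product.Base using (_×_; _,_; ∃; ∃₂; proj₁; proj₂)
open import Data.Rational.Base as ℚ using (ℚ; 0ℚ; 1ℚ)
import Data.Rational.Properties as ℚₚ
open import Data.Rational.Solver using (module +-*-Solver)
open import Data.Sum.Base as Sum using (_⊎_; inj₁; inj₂)
open import Data.Vec.Base as Vec using (Vec; []; _∷_; lookup; tabulate)
import Data.Vec.Properties as Vecₚ
open import Function.Base using (_∘_; id; case_of_)
open import Function.Bundles using (Inverse)
open import Induction.WellFounded using (Acc; acc)
open import Level using (0ℓ)
open import Relation.Binary.Definitions using (DecidableEquality; tri<; tri≈; tri>)
open import Relation.Binary.PropositionalEquality
open import Relation.Nullary
open import Relation.Nullary.Decidable using (dec-true; dec-false; _×-dec_; _→-dec_; ¬?)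
open import Relation.Unary using (Pred; Decidable; _∈_; _⊆_)

open import Defs

-- The Garsia-Stanton monomials are not closed under taking divisors: for n = k = 3, x₁x₃ is one of
-- them and x₁ is not. Hence no monomial order has them as its standard monomials, and Gröbner bases
-- do not apply directly. Accordingly the rank is quadratic in the exponents and not compatible with
-- multiplication. What takes the place of compatibility is that two top sets of the same monomial c
-- are nested, so the product of both top sets dominates the expansion of x^c e_d e_d′, whichever
-- factor is expanded first. The link with permutations: let π sort the letters of a by decreasing
-- weight. Its exponents then fall at each step by at least 1 at a descent of π and by at least 0
-- elsewhere. The monomial a is a leading monomial of E exactly when, at some position from n - k on
-- (counted from 0), they fall by more than that, where the last fall is the one to 0. If this never
-- happens, the exponents from there on are those of gs_π, and what exceeds gs_π at the earlier
-- positions is the chain i₁ ≥ ⋯ ≥ i_{n-k}. The bound k - des π expresses that no k-th power divides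
-- a.

private
  variable
    n : ℕ
    X Y : Set

-- Polynomials as linear combinations of monomials

-- The linear functional with value `g u` at the monomial `u`. Through it, identities between lists
-- with repeated terms become identities in ℚ, and products become a change of `g`.
eval : (Monomial n → ℚ) → Polynomial n → ℚ
eval g = foldr (λ (c , u) s → c ℚ.* g u ℚ.+ s) 0ℚ

infix 4 _≋_

-- Equivalent to `_≈ₚ_`, which tests only the functionals `δ u`. Quantifying over all `g` makes
-- compatibility with `bind` and multiplication immediate.
_≋_ : Polynomial n → Polynomial n → Set
f ≋ h = ∀ g → eval g f ≡ eval g h

eval-+ : ∀ g (f h : Polynomial n) → eval g (f +ₚ h) ≡ eval g f ℚ.+ eval g h
eval-+ g []            h = sym (ℚₚ.+-identityˡ _)
eval-+ g ((c , u) ∷ f) h =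
  trans (cong (c ℚ.* g u ℚ.+_) (eval-+ g f h)) (sym (ℚₚ.+-assoc (c ℚ.* g u) _ _))

eval-• : ∀ g c (f : Polynomial n) → eval g (c • f) ≡ c ℚ.* eval g f
eval-• g c []            = sym (ℚₚ.*-zeroʳ c)
eval-• g c ((d , u) ∷ f) = trans (cong ((c ℚ.* d) ℚ.* g u ℚ.+_) (eval-• g c f))
  (solve 4 (λ c d a e → (c :* d) :* a :+ c :* e := c :* (d :* a :+ e)) refl c d (g u) (eval g f))
  where open +-*-Solver

eval-cong : ∀ {g h : Monomial n → ℚ} (f : Polynomial n) → (∀ u → g u ≡ h u) → eval g f ≡ eval h f
eval-cong []            g≗h = refl
eval-cong ((c , u) ∷ f) g≗h = cong₂ (λ a b → c ℚ.* a ℚ.+ b) (g≗h u) (eval-cong f g≗h)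

eval-linear : ∀ g h r (f : Polynomial n) →
              eval (λ u → g u ℚ.+ r ℚ.* h u) f ≡ eval g f ℚ.+ r ℚ.* eval h f
eval-linear g h r []            = sym (trans (ℚₚ.+-identityˡ _) (ℚₚ.*-zeroʳ r))
eval-linear g h r ((c , u) ∷ f) = trans (cong (c ℚ.* (g u ℚ.+ r ℚ.* h u) ℚ.+_) (eval-linear g h r f))
  (solve 6 (λ c a r b x y → c :* (a :+ r :* b) :+ (x :+ r :* y)
                            := (c :* a :+ x) :+ r :* (c :* b :+ y))
           refl c (g u) r (h u) (eval g f) (eval h f))
  where open +-*-Solver

eval-*ᵐ : ∀ g c w (f : Polynomial n) →
          eval g (List.map (λ (d , v) → c ℚ.* d , w · v) f) ≡ c ℚ.* eval (λ v → g (w · v)) f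
eval-*ᵐ g c w []            = sym (ℚₚ.*-zeroʳ c)
eval-*ᵐ g c w ((d , v) ∷ f) = trans (cong ((c ℚ.* d) ℚ.* g (w · v) ℚ.+_) (eval-*ᵐ g c w f))
  (solve 4 (λ c d a e → (c :* d) :* a :+ c :* e := c :* (d :* a :+ e))
           refl c d (g (w · v)) (eval (λ v → g (w · v)) f))
  where open +-*-Solver

eval-* : ∀ g (f h : Polynomial n) →
         eval g (f *ₚ h) ≡ eval (λ u → eval (λ v → g (u · v)) h) f
eval-* g []            h = refl
eval-* g ((c , w) ∷ f) h =
  trans (eval-+ g (List.map (λ (d , v) → c ℚ.* d , w · v) h) (f *ₚ h))
        (cong₂ ℚ._+_ (eval-*ᵐ g c w h) (eval-* g f h))

eval-monomial : ∀ g (u : Monomial n) → eval g (monomial u) ≡ g u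
eval-monomial g u = trans (ℚₚ.+-identityʳ _) (ℚₚ.*-identityˡ _)

eval-shift : ∀ g w (f : Polynomial n) → eval g (monomial w *ₚ f) ≡ eval (λ v → g (w · v)) f
eval-shift g w f = trans (eval-* g (monomial w) f)
                         (eval-monomial (λ u → eval (λ v → g (u · v)) f) w)

infix 4 _≟ᵐ_

_≟ᵐ_ : DecidableEquality (Monomial n)
_≟ᵐ_ = Vecₚ.≡-dec ℕₚ._≟_

δ : Monomial n → Monomial n → ℚ
δ u w = if does (w ≟ᵐ u) then 1ℚ else 0ℚ

coeff≡eval : ∀ (f : Polynomial n) u → coeff f u ≡ eval (δ u) f
coeff≡eval []            u = refl
coeff≡eval ((c , w) ∷ f) u with w ≟ᵐ u
... | yes _ = cong₂ ℚ._+_ (sym (ℚₚ.*-identityʳ c)) (coeff≡eval f u)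
... | no  _ = cong₂ ℚ._+_ (sym (ℚₚ.*-zeroʳ c)) (coeff≡eval f u)

≋⇒≈ₚ : (f h : Polynomial n) → f ≋ h → f ≈ₚ h
≋⇒≈ₚ f h f≋h u = trans (coeff≡eval f u) (trans (f≋h (δ u)) (sym (coeff≡eval h u)))

-- Lowering h to 0 at one monomial a changes eval h f by h a · coeff f a, which
-- vanishes; after doing this for all monomials of f nothing is left.

module _ (f : Polynomial n) where

  private
    lower : (Monomial n → ℚ) → Monomial n → Monomial n → ℚ
    lower h a u = h u ℚ.+ (ℚ.- h a) ℚ.* δ a u

    lower-self : ∀ h a → lower h a a ≡ 0ℚ
    lower-self h a with a ≟ᵐ a
    ... | yes _  = solve 1 (λ b → b :+ (:- b) :* con 1ℚ := con 0ℚ) refl (h a)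
      where open +-*-Solver
    ... | no a≢a = contradiction refl a≢a

    lower-zero : ∀ h a u → h u ≡ 0ℚ → lower h a u ≡ 0ℚ
    lower-zero h a u hu≡0 with u ≟ᵐ a
    ... | yes refl rewrite hu≡0 = refl
    ... | no  _    rewrite hu≡0 = trans (ℚₚ.+-identityˡ _) (ℚₚ.*-zeroʳ (ℚ.- h a))

    eval-lower : ∀ h a → coeff f a ≡ 0ℚ ⊎ h a ≡ 0ℚ → eval (lower h a) f ≡ eval h f
    eval-lower h a z = trans (eval-linear h (δ a) (ℚ.- h a) f)
      (trans (cong (eval h f ℚ.+_) (vanish z)) (ℚₚ.+-identityʳ _))
      where
      vanish : coeff f a ≡ 0ℚ ⊎ h a ≡ 0ℚ → ((ℚ.- h a) ℚ.* eval (δ a) f) ≡ 0ℚ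
      vanish (inj₁ p) = trans (cong ((ℚ.- h a) ℚ.*_) (trans (sym (coeff≡eval f a)) p))
                              (ℚₚ.*-zeroʳ (ℚ.- h a))
      vanish (inj₂ q) = trans (cong (λ b → (ℚ.- b) ℚ.* eval (δ a) f) q) (ℚₚ.*-zeroˡ (eval (δ a) f))

    eval-zero : ∀ h (l : Polynomial n) → All (λ (_ , u) → h u ≡ 0ℚ) l → eval h l ≡ 0ℚ
    eval-zero h []            []       = refl
    eval-zero h ((c , u) ∷ f) (p ∷ ps) =
      trans (cong₂ (λ a b → c ℚ.* a ℚ.+ b) p (eval-zero h f ps))
            (trans (ℚₚ.+-identityʳ _) (ℚₚ.*-zeroʳ c))

    lowerAll : (l : List (ℚ × Monomial n)) (h : Monomial n → ℚ) →
               (∀ a → coeff f a ≡ 0ℚ ⊎ h a ≡ 0ℚ) →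
               ∃ λ h′ → eval h′ f ≡ eval h f × All (λ (_ , u) → h′ u ≡ 0ℚ) l ×
                        (∀ a → h a ≡ 0ℚ → h′ a ≡ 0ℚ)
    lowerAll []            h z = h , refl , [] , λ _ p → p
    lowerAll ((_ , a) ∷ l) h z
      with h′ , e , zs , keep ← lowerAll l (lower h a)
             (λ b → Sum.map₂ (lower-zero h a b) (z b))
      = h′ , trans e (eval-lower h a (z a)) , keep a (lower-self h a) ∷ zs
           , λ b p → keep b (lower-zero h a b p)

  eval-vanish : ∀ h → (∀ a → coeff f a ≡ 0ℚ ⊎ h a ≡ 0ℚ) → eval h f ≡ 0ℚ
  eval-vanish h z with h′ , e , zs , _ ← lowerAll f h z = trans (sym e) (eval-zero h′ f zs)

-- A functional may be changed freely at monomials with coefficient 0, even if these occur in the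
-- list with coefficients that cancel.
eval-agree : ∀ (f : Polynomial n) g h → (∀ a → coeff f a ≡ 0ℚ ⊎ g a ≡ h a) →
             eval g f ≡ eval h f
eval-agree f g h z = begin
  eval g f
    ≡⟨ solve 2 (λ a b → a := (a :+ con (ℚ.- 1ℚ) :* b) :+ b) refl (eval g f) (eval h f) ⟩
  (eval g f ℚ.+ (ℚ.- 1ℚ) ℚ.* eval h f) ℚ.+ eval h f
    ≡⟨ cong (ℚ._+ eval h f) (eval-linear g h (ℚ.- 1ℚ) f) ⟨
  eval (λ u → g u ℚ.+ (ℚ.- 1ℚ) ℚ.* h u) f ℚ.+ eval h f
    ≡⟨ cong (ℚ._+ eval h f) (eval-vanish f (λ u → g u ℚ.+ (ℚ.- 1ℚ) ℚ.* h u) λ a → Sum.map₂ (cancel a) (z a)) ⟩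
  0ℚ ℚ.+ eval h f
    ≡⟨ ℚₚ.+-identityˡ _ ⟩
  eval h f ∎
  where
  open ≡-Reasoning
  open +-*-Solver
  cancel : ∀ a → g a ≡ h a → g a ℚ.+ (ℚ.- 1ℚ) ℚ.* h a ≡ 0ℚ
  cancel a p rewrite p = solve 1 (λ b → b :+ con (ℚ.- 1ℚ) :* b := con 0ℚ) refl (h a)

≈ₚ⇒≋ : (f h : Polynomial n) → f ≈ₚ h → f ≋ h
≈ₚ⇒≋ f h f≈h g = begin
  eval g f
    ≡⟨ solve 2 (λ a b → a := (a :+ con (ℚ.- 1ℚ) :* b) :+ b) refl (eval g f) (eval g h) ⟩
  (eval g f ℚ.+ (ℚ.- 1ℚ) ℚ.* eval g h) ℚ.+ eval g h
    ≡⟨ cong (λ a → (eval g f ℚ.+ a) ℚ.+ eval g h) (eval-• g (ℚ.- 1ℚ) h) ⟨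
  (eval g f ℚ.+ eval g (-ₚ h)) ℚ.+ eval g h
    ≡⟨ cong (ℚ._+ eval g h) (eval-+ g f (-ₚ h)) ⟨
  eval g (f +ₚ -ₚ h) ℚ.+ eval g h
    ≡⟨ cong (ℚ._+ eval g h) (eval-vanish (f +ₚ -ₚ h) g λ a → inj₁ (coeff-zero a)) ⟩
  0ℚ ℚ.+ eval g h
    ≡⟨ ℚₚ.+-identityˡ _ ⟩
  eval g h ∎
  where
  open ≡-Reasoning
  open +-*-Solver
  coeff-zero : ∀ a → coeff (f +ₚ -ₚ h) a ≡ 0ℚ
  coeff-zero a = trans (coeff-- f h a) (trans (cong (ℚ._+ _) (f≈h a))
    (solve 1 (λ b → b :+ con (ℚ.- 1ℚ) :* b := con 0ℚ) refl (coeff h a)))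

bind : (Monomial n → Polynomial n) → Polynomial n → Polynomial n
bind F = foldr (λ (c , u) f → c • F u +ₚ f) 0ₚ

eval-bind : ∀ g F (f : Polynomial n) → eval g (bind F f) ≡ eval (λ u → eval g (F u)) f
eval-bind g F []            = refl
eval-bind g F ((c , u) ∷ f) =
  trans (eval-+ g (c • F u) (bind F f)) (cong₂ ℚ._+_ (eval-• g c (F u)) (eval-bind g F f))

coeff-off-support : ∀ (f : Polynomial n) u → All (λ (_ , w) → w ≢ u) f → coeff f u ≡ 0ℚ
coeff-off-support []            u []       = refl
coeff-off-support ((c , w) ∷ f) u (w≢u ∷ ps) with w ≟ᵐ u
... | yes w≡u = contradiction w≡u w≢u
... | no  _   = trans (ℚₚ.+-identityˡ _) (coeff-off-support f u ps)

coeff-filter : ∀ {P : Pred (Monomial n) 0ℓ} (P? : Decidable P) f u → P u →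
               coeff (List.filter (P? ∘ proj₂) f) u ≡ coeff f u
coeff-filter P? []            u p = refl
coeff-filter P? ((c , w) ∷ f) u p with P? w
... | yes _ = cong ((if does (w ≟ᵐ u) then c else 0ℚ) ℚ.+_) (coeff-filter P? f u p)
... | no ¬p with w ≟ᵐ u
...   | yes refl = contradiction p ¬p
...   | no _     = trans (coeff-filter P? f u p) (sym (ℚₚ.+-identityˡ _))

-- Subspaces and spans of families of polynomials.

record IsSubspace (V : Pred (Polynomial n) 0ℓ) : Set where
  field
    has-0      : 0ₚ ∈ V
    closed-+   : ∀ {f h} → f ∈ V → h ∈ V → f +ₚ h ∈ V
    closed-•   : ∀ c {f} → f ∈ V → c • f ∈ V
    closed-≋   : ∀ {f h} → f ≋ h → f ∈ V → h ∈ V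

  closed-bind : ∀ F {f} → All (λ (_ , u) → F u ∈ V) f → bind F f ∈ V
  closed-bind F {[]}          []       = has-0
  closed-bind F {(c , u) ∷ f} (p ∷ ps) = closed-+ (closed-• c p) (closed-bind F ps)

  closed-terms : ∀ {f} → All (λ (_ , u) → monomial u ∈ V) f → f ∈ V
  closed-terms {f} ps = closed-≋
    (λ g → trans (eval-bind g monomial f) (eval-cong f (eval-monomial g)))
    (closed-bind monomial ps)

-- The coefficient list is itself a polynomial, whose monomials are the indices into the family, so
-- `coeff` and `eval` apply to it.
record Span (Q : Pred (Monomial n) 0ℓ) (F : Monomial n → Polynomial n) (f : Polynomial n) : Set where
  constructor combination
  field
    coefficients : Polynomial n
    indices      : All (Q ∘ proj₂) coefficients
    equality     : f ≋ bind F coefficients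

module _ {Q : Pred (Monomial n) 0ℓ} {F : Monomial n → Polynomial n} where

  Span-isSubspace : IsSubspace (Span Q F)
  Span-isSubspace = record
    { has-0    = combination [] [] λ _ → refl
    ; closed-+ = λ { {f} {h} (combination ts qs e) (combination ts′ qs′ e′) →
        combination (ts +ₚ ts′) (Allₚ.++⁺ qs qs′) λ g → begin
          eval g (f +ₚ h)                       ≡⟨ eval-+ g f h ⟩
          eval g f ℚ.+ eval g h                 ≡⟨ cong₂ ℚ._+_ (trans (e g) (eval-bind g F ts))
                                                              (trans (e′ g) (eval-bind g F ts′)) ⟩
          eval _ ts ℚ.+ eval _ ts′              ≡⟨ eval-+ _ ts ts′ ⟨
          eval _ (ts +ₚ ts′)                    ≡⟨ eval-bind g F (ts +ₚ ts′) ⟨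
          eval g (bind F (ts +ₚ ts′))           ∎ }
    ; closed-• = λ { c {f} (combination ts qs e) →
        combination (c • ts) (Allₚ.map⁺ qs) λ g → begin
          eval g (c • f)             ≡⟨ eval-• g c f ⟩
          c ℚ.* eval g f             ≡⟨ cong (c ℚ.*_) (trans (e g) (eval-bind g F ts)) ⟩
          c ℚ.* eval _ ts            ≡⟨ eval-• _ c ts ⟨
          eval _ (c • ts)            ≡⟨ eval-bind g F (c • ts) ⟨
          eval g (bind F (c • ts))   ∎ }
    ; closed-≋ = λ { f≋h (combination ts qs e) → combination ts qs λ g → trans (sym (f≋h g)) (e g) }
    }
    where open ≡-Reasoning

  Span-generator : ∀ {a} → Q a → Span Q F (F a)
  Span-generator {a} q = combination (monomial a) (q ∷ []) λ g →
    sym (trans (eval-bind g F (monomial a)) (eval-monomial (eval g ∘ F) a))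

  Span-mono : ∀ {V} → IsSubspace V → (∀ {a} → Q a → F a ∈ V) → Span Q F ⊆ V
  Span-mono V-sub F∈V (combination ts qs e) =
    closed-≋ (sym ∘ e) (closed-bind F (All.map F∈V qs))
    where open IsSubspace V-sub

-- Families with distinct leading monomials.

module _ (ρ : Monomial n → ℕ) where

  -- Distinct monomials may share a rank: the leading term only has to lie strictly above the
  -- remaining terms of its own polynomial.
  Leads : Monomial n → Polynomial n → Set
  Leads a f = ∃ λ rest → f ≋ (1ℚ , a) ∷ rest × All (λ (_ , u) → ρ u < ρ a) rest

  monomial-leads : ∀ a → Leads a (monomial a)
  monomial-leads a = [] , (λ _ → refl) , []

  module _ {F : Monomial n → Polynomial n} (leads : ∀ a → Leads a (F a)) where

    private
      coeff-F : ∀ a u → ρ a ≤ ρ u → eval (δ u) (F a) ≡ δ u a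
      coeff-F a u ρa≤ρu with rest , e , lower ← leads a = begin
        eval (δ u) (F a)                     ≡⟨ e (δ u) ⟩
        1ℚ ℚ.* δ u a ℚ.+ eval (δ u) rest     ≡⟨ cong₂ ℚ._+_ (ℚₚ.*-identityˡ (δ u a))
                                                  (trans (sym (coeff≡eval rest u))
                                                    (coeff-off-support rest u (All.map
                                                      (λ { p refl → ℕₚ.<⇒≱ p ρa≤ρu }) lower))) ⟩
        δ u a ℚ.+ 0ℚ                         ≡⟨ ℚₚ.+-identityʳ _ ⟩
        δ u a                                ∎
        where open ≡-Reasoning

      bound : (f : Polynomial n) → ∃ λ N → All (λ (_ , u) → ρ u < N) f
      bound []            = 0 , []
      bound ((_ , u) ∷ f) with N , ps ← bound f =
        suc (ρ u) ⊔ N , ℕₚ.m≤m⊔n _ N ∷ All.map (λ p → ℕₚ.<-≤-trans p (ℕₚ.m≤n⊔m (suc (ρ u)) N)) ps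

    -- Descending induction on the rank: in `bind F f` the monomial `u` receives its own coefficient
    -- from `f` and contributions of indices of larger rank, whose coefficients are already known to
    -- vanish.
    triangular : ∀ r f → (∀ u → r ≤ ρ u → coeff (bind F f) u ≡ 0ℚ) →
                 ∀ u → r ≤ ρ u → coeff f u ≡ 0ℚ
    triangular r f zs u r≤ with N , below ← bound f = go N u r≤ (ℕₚ.m≤m+n N (ρ u))
      where
      -- `m` bounds the distance from the rank of `u` up to `N`; at 0 the rank is too large for `u`
      -- to occur in `f`.
      go : ∀ m u → r ≤ ρ u → N ≤ m + ρ u → coeff f u ≡ 0ℚ
      go zero    u r≤ N≤ = coeff-off-support f u
        (All.map (λ { p refl → ℕₚ.<⇒≱ p N≤ }) below)
      go (suc m) u r≤ N≤ = begin
        coeff f u                            ≡⟨ coeff≡eval f u ⟩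
        eval (δ u) f                         ≡⟨ eval-agree f _ _ agree ⟨
        eval (λ a → eval (δ u) (F a)) f      ≡⟨ eval-bind (δ u) F f ⟨
        eval (δ u) (bind F f)                ≡⟨ coeff≡eval (bind F f) u ⟨
        coeff (bind F f) u                   ≡⟨ zs u r≤ ⟩
        0ℚ                                   ∎
        where
        open ≡-Reasoning
        agree : ∀ a → coeff f a ≡ 0ℚ ⊎ eval (δ u) (F a) ≡ δ u a
        agree a with ρ a ℕₚ.≤? ρ u
        ... | yes ρa≤ρu = inj₂ (coeff-F a u ρa≤ρu)
        ... | no  ρa≰ρu = inj₁ (go m a (ℕₚ.≤-trans r≤ (ℕₚ.<⇒≤ ρu<ρa))
                (ℕₚ.≤-trans N≤ (ℕₚ.≤-trans (ℕₚ.≤-reflexive (sym (ℕₚ.+-suc m (ρ u)))) (ℕₚ.+-monoʳ-≤ m ρu<ρa))))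
          where ρu<ρa = ℕₚ.≰⇒> ρa≰ρu

    -- Leading terms cannot cancel: by `triangular` the coefficients at indices of rank at least `r`
    -- sum to 0, so these indices can be filtered out. This supplies the smaller indices for an
    -- induction on the rank.
    Span-lower : ∀ {Q : Pred (Monomial n) 0ℓ} r f → Span Q F f → All (λ (_ , u) → ρ u < r) f →
                 Span (λ a → Q a × ρ a < r) F f
    Span-lower {Q} r f (combination ts qs e) f<r = combination
      (List.filter below? ts)
      (All.zip (Allₚ.filter⁺ below? qs , Allₚ.all-filter below? ts))
      λ g → trans (e g) (trans (eval-bind g F ts)
          (trans (≈ₚ⇒≋ ts (List.filter below? ts) filtered (λ u → eval g (F u))) (sym (eval-bind g F (List.filter below? ts)))))
      where
      below? : ∀ (t : ℚ × Monomial n) → Dec (ρ (proj₂ t) < r)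
      below? (_ , a) = ρ a ℕₚ.<? r

      high : ∀ u → r ≤ ρ u → coeff ts u ≡ 0ℚ
      high = triangular r ts λ u r≤ → trans (sym (≋⇒≈ₚ f (bind F ts) e u))
        (coeff-off-support f u (All.map (λ { p refl → ℕₚ.<⇒≱ p r≤ }) f<r))

      filtered : ts ≈ₚ List.filter below? ts
      filtered u with ρ u ℕₚ.<? r
      ... | yes ρu<r = sym (coeff-filter (λ a → ρ a ℕₚ.<? r) ts u ρu<r)
      ... | no  ρu≮r = trans (high u (ℕₚ.≮⇒≥ ρu≮r)) (sym (coeff-off-support (List.filter below? ts) u
              (All.map (λ { p refl → ρu≮r p }) (Allₚ.all-filter below? ts))))

-- The rank and its leading monomials

lookup-extensional : {A : Set} {u v : Vec A n} → (∀ l → lookup u l ≡ lookup v l) → u ≡ v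
lookup-extensional {u = u} {v} e =
  trans (sym (Vecₚ.tabulate∘lookup u)) (trans (Vecₚ.tabulate-cong e) (Vecₚ.tabulate∘lookup v))

sum-mono-≤ : (f g : Fin n → ℕ) → (∀ l → f l ≤ g l) → sum f ≤ sum g
sum-mono-≤ {zero}  f g f≤g = z≤n
sum-mono-≤ {suc n} f g f≤g = +-mono-≤ (f≤g zero) (sum-mono-≤ (f ∘ suc) (g ∘ suc) (f≤g ∘ suc))

sum-mono-< : (f g : Fin n → ℕ) → (∀ l → f l ≤ g l) → ∀ l → f l < g l → sum f < sum g
sum-mono-< f g f≤g zero    p = +-mono-<-≤ p (sum-mono-≤ (f ∘ suc) (g ∘ suc) (f≤g ∘ suc))
sum-mono-< f g f≤g (suc l) p =
  +-mono-≤-< (f≤g zero) (sum-mono-< (f ∘ suc) (g ∘ suc) (f≤g ∘ suc) l p)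

ind : Subset n → Fin n → ℕ
ind T l = if lookup T l then 1 else 0

∣∣≡sum : (T : Subset n) → ∣ T ∣ ≡ sum (ind T)
∣∣≡sum []          = refl
∣∣≡sum (true  ∷ T) = cong suc (∣∣≡sum T)
∣∣≡sum (false ∷ T) = ∣∣≡sum T

lookup-· : ∀ (u v : Monomial n) l → lookup (u · v) l ≡ lookup u l + lookup v l
lookup-· u v l = Vecₚ.lookup-zipWith _+_ l u v

lookup-·-squarefree : ∀ u (T : Subset n) l → lookup (u · squarefree T) l ≡ lookup u l + ind T l
lookup-·-squarefree u T l =
  trans (lookup-· u (squarefree T) l) (cong (lookup u l +_) (Vecₚ.lookup-map l _ T))

·-comm : (u v : Monomial n) → u · v ≡ v · u
·-comm = Vecₚ.zipWith-comm +-comm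

·-assoc : (u v w : Monomial n) → (u · v) · w ≡ u · (v · w)
·-assoc = Vecₚ.zipWith-assoc +-assoc

·-cancelˡ : ∀ (u : Monomial n) {v w} → u · v ≡ u · w → v ≡ w
·-cancelˡ []      {[]}    {[]}    e = refl
·-cancelˡ (a ∷ u) {b ∷ v} {c ∷ w} e =
  cong₂ _∷_ (+-cancelˡ-≡ a b c (Vecₚ.∷-injectiveˡ e)) (·-cancelˡ u (Vecₚ.∷-injectiveʳ e))

-- Letters are ordered by exponent and, for equal exponents, by index with the
-- smaller letter first; the weight encodes this order in one number.

weight : Monomial n → Fin n → ℕ
weight {n} c l = lookup c l * n + toℕ (opposite l)

opposite<n : (l : Fin n) → toℕ (opposite l) < n
opposite<n l = Finₚ.toℕ<n (opposite l)

quotient-≤ : ∀ a b {h h′} → h′ < n → a * n + h ≤ b * n + h′ → a ≤ b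
quotient-≤ {n} a b {h} {h′} h′<n p = ≮⇒≥ λ b<a → <⇒≱ (begin-strict
  b * n + h′   <⟨ +-monoʳ-< (b * n) h′<n ⟩
  b * n + n    ≡⟨ +-comm (b * n) n ⟩
  suc b * n    ≤⟨ *-monoˡ-≤ n b<a ⟩
  a * n        ≤⟨ m≤m+n (a * n) h ⟩
  a * n + h    ∎) p
  where open ≤-Reasoning

opposite-injective : {l m : Fin n} → opposite l ≡ opposite m → l ≡ m
opposite-injective {l = l} {m} e =
  trans (sym (Finₚ.opposite-involutive l)) (trans (cong opposite e) (Finₚ.opposite-involutive m))

opposite-antitone : {l m : Fin n} → l Fin.< m → toℕ (opposite m) < toℕ (opposite l)
opposite-antitone {l = l} {m} l<m = subst₂ _<_ (sym (Finₚ.opposite-prop m)) (sym (Finₚ.opposite-prop l))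
  (∸-monoʳ-< (s≤s l<m) (Finₚ.toℕ<n m))

weight-injective : ∀ (c : Monomial n) {l m} → weight c l ≡ weight c m → l ≡ m
weight-injective {n} c {l} {m} e = opposite-injective (Finₚ.toℕ-injective
  (+-cancelˡ-≡ (lookup c l * n) _ _ (trans e (cong (λ a → a * n + toℕ (opposite m)) (sym exponents)))))
  where
  exponents : lookup c l ≡ lookup c m
  exponents = ≤-antisym (quotient-≤ _ _ (opposite<n m) (≤-reflexive e))
                        (quotient-≤ _ _ (opposite<n l) (≤-reflexive (sym e)))

weight-·-squarefree : ∀ c (T : Subset n) l → weight (c · squarefree T) l ≡ weight c l + ind T l * n
weight-·-squarefree {n} c T l rewrite lookup-·-squarefree c T l =
  lemma (lookup c l) (ind T l) n (toℕ (opposite l))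
  where
  lemma : ∀ a b n h → (a + b) * n + h ≡ (a * n + h) + b * n
  lemma = solve-∀

-- rank c is chosen so that raising the exponent of l by one increases it by
-- weight c l.

rankAt : ℕ → ℕ → ℕ → ℕ
rankAt n h zero    = 0
rankAt n h (suc v) = rankAt n h v + (v * n + h)

rank : Monomial n → ℕ
rank {n} c = sum λ l → rankAt n (toℕ (opposite l)) (lookup c l)

totalWeight : Monomial n → Subset n → ℕ
totalWeight c T = sum λ l → ind T l * weight c l

rank-·-squarefree : ∀ c (T : Subset n) → rank (c · squarefree T) ≡ rank c + totalWeight c T
rank-·-squarefree {n} c T = trans (sum-cong-≗ step)
  (∑-distrib-+ (λ l → rankAt n (toℕ (opposite l)) (lookup c l)) (λ l → ind T l * weight c l))
  where
  step : ∀ l → rankAt n (toℕ (opposite l)) (lookup (c · squarefree T) l)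
             ≡ rankAt n (toℕ (opposite l)) (lookup c l) + ind T l * weight c l
  step l rewrite lookup-·-squarefree c T l with lookup T l
  ... | false rewrite +-identityʳ (lookup c l) = sym (+-identityʳ _)
  ... | true  rewrite +-comm (lookup c l) 1    = cong (rankAt n (toℕ (opposite l)) (lookup c l) +_) (sym (+-identityʳ _))

-- T consists of the ∣T∣ letters of largest weight, so c · squarefree T is the
-- monomial of largest rank in x^c e_∣T∣.

record Top (c : Monomial n) (T : Subset n) : Set where
  field
    threshold : ℕ
    inside≥   : ∀ l → lookup T l ≡ true  → threshold ≤ weight c l
    outside<  : ∀ l → lookup T l ≡ false → weight c l < threshold

open Top

ind≤1 : ∀ (T : Subset n) l → ind T l ≤ 1
ind≤1 T l with lookup T l
... | true  = ≤-refl
... | false = z≤n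

⊆∧∣∣≥⇒≡ : (S T : Subset n) → (∀ l → lookup S l ≡ true → lookup T l ≡ true) → ∣ T ∣ ≤ ∣ S ∣ → S ≡ T
⊆∧∣∣≥⇒≡ S T S⊆T ∣T∣≤∣S∣ = lookup-extensional λ l →
  case Boolₚ._≟_ (lookup S l) (lookup T l) of λ
    { (yes p) → p
    ; (no ¬p) → contradiction ∣T∣≤∣S∣ (<⇒≱ (subst₂ _<_ (sym (∣∣≡sum S)) (sym (∣∣≡sum T))
                  (sum-mono-< (ind S) (ind T) ind≤ l (ind< l ¬p)))) }
  where
  ind≤ : ∀ l → ind S l ≤ ind T l
  ind≤ l with lookup S l in e
  ... | false = z≤n
  ... | true rewrite S⊆T l e = ≤-refl
  ind< : ∀ l → lookup S l ≢ lookup T l → ind S l < ind T l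
  ind< l ne with lookup S l in e | lookup T l in e′
  ... | false | true  = s≤s z≤n
  ... | false | false = contradiction refl ne
  ... | true  | true  = contradiction refl ne
  ... | true  | false = contradiction (trans (sym (S⊆T l e)) e′) λ ()

-- Exchange argument: letters of `S` outside `T` weigh less than θ, and letters of `T` outside `S`
-- at least θ. Adding θ once for each letter of the other set makes the comparison letterwise, and
-- these additions cancel because the sizes agree.
Top-maximal : ∀ {c} {S T : Subset n} → Top c T → ∣ S ∣ ≡ ∣ T ∣ →
              S ≡ T ⊎ totalWeight c S < totalWeight c T
Top-maximal {n} {c} {S} {T} top e
  with Finₚ.any? (λ l → (lookup S l Boolₚ.≟ true) ×-dec (lookup T l Boolₚ.≟ false))
... | no ∄l = inj₁ (⊆∧∣∣≥⇒≡ S T S⊆T (≤-reflexive (sym e)))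
  where
  S⊆T : ∀ l → lookup S l ≡ true → lookup T l ≡ true
  S⊆T l p with lookup T l in q
  ... | true  = refl
  ... | false = contradiction (l , p , q) ∄l
... | yes (l₀ , p , q) = inj₂ (+-cancelʳ-< (∣ S ∣ * θ) _ _ (begin-strict
  totalWeight c S + ∣ S ∣ * θ   ≡⟨ cong (λ s → totalWeight c S + s * θ) e ⟩
  totalWeight c S + ∣ T ∣ * θ   ≡⟨ split S T ⟩
  sum (λ l → ind S l * weight c l + ind T l * θ)
    <⟨ sum-mono-< _ _ exchange l₀ exchange-< ⟩
  sum (λ l → ind T l * weight c l + ind S l * θ)
    ≡⟨ split T S ⟨
  totalWeight c T + ∣ S ∣ * θ   ∎))
  where
  open ≤-Reasoning
  θ = threshold top
  split : ∀ A B → totalWeight c A + ∣ B ∣ * θ ≡ sum (λ l → ind A l * weight c l + ind B l * θ)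
  split A B = trans
    (cong (totalWeight c A +_) (trans (cong (_* θ) (∣∣≡sum B)) (*-distribʳ-sum θ (ind B))))
    (sym (∑-distrib-+ (λ l → ind A l * weight c l) (λ l → ind B l * θ)))
  exchange : ∀ l → ind S l * weight c l + ind T l * θ ≤ ind T l * weight c l + ind S l * θ
  exchange l with lookup S l | lookup T l in t
  ... | true  | true  = ≤-refl
  ... | false | false = z≤n
  ... | false | true  = ≤-trans (+-monoˡ-≤ 0 (inside≥ top l t)) (m≤m+n _ 0)
  ... | true  | false = ≤-trans (≤-reflexive (+-identityʳ _)) (+-monoˡ-≤ 0 (<⇒≤ (outside< top l t)))
  exchange-< : ind S l₀ * weight c l₀ + ind T l₀ * θ < ind T l₀ * weight c l₀ + ind S l₀ * θ
  exchange-< rewrite p | q = ≤-trans (s≤s (≤-reflexive (+-identityʳ _))) (+-monoˡ-< 0 (outside< top l₀ q))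

Top-maximal-≤ : ∀ {c} {S T : Subset n} → Top c T → ∣ S ∣ ≡ ∣ T ∣ →
                totalWeight c S ≤ totalWeight c T
Top-maximal-≤ {S = S} top e with Top-maximal {S = S} top e
... | inj₁ refl = ≤-refl
... | inj₂ p    = <⇒≤ p

-- The size of the intersection of `S` and `T`.
common : Subset n → Subset n → ℕ
common S T = sum λ l → ind S l * ind T l

-- Multiplication by `squarefree T` makes each letter of `T` heavier by `n`, so every letter shared
-- with `S` contributes `n` more.
totalWeight-· : ∀ c (S T : Subset n) →
  totalWeight (c · squarefree T) S ≡ totalWeight c S + common S T * n
totalWeight-· {n} c S T = begin
  totalWeight (c · squarefree T) S
    ≡⟨ sum-cong-≗ (λ l → trans (cong (ind S l *_) (weight-·-squarefree c T l))
                               (lemma (ind S l) (weight c l) (ind T l) n)) ⟩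
  sum (λ l → ind S l * weight c l + ind S l * ind T l * n)
    ≡⟨ ∑-distrib-+ (λ l → ind S l * weight c l) (λ l → ind S l * ind T l * n) ⟩
  totalWeight c S + sum (λ l → ind S l * ind T l * n)
    ≡⟨ cong (totalWeight c S +_) (*-distribʳ-sum n (λ l → ind S l * ind T l)) ⟨
  totalWeight c S + common S T * n  ∎
  where
  open ≡-Reasoning
  lemma : ∀ s w t n → s * (w + t * n) ≡ s * w + s * t * n
  lemma = solve-∀

common≤ˡ : (S T : Subset n) → common S T ≤ ∣ S ∣
common≤ˡ S T = ≤-trans (sum-mono-≤ _ _ λ l →
    ≤-trans (*-monoʳ-≤ (ind S l) (ind≤1 T l)) (≤-reflexive (*-identityʳ _)))
  (≤-reflexive (sym (∣∣≡sum S)))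

common-comm : (S T : Subset n) → common S T ≡ common T S
common-comm S T = sum-cong-≗ λ l → *-comm (ind S l) (ind T l)

common-⊆ : (S T : Subset n) → (∀ l → lookup S l ≡ true → lookup T l ≡ true) → common S T ≡ ∣ S ∣
common-⊆ S T S⊆T = trans (sum-cong-≗ pointwise) (sym (∣∣≡sum S))
  where
  pointwise : ∀ l → ind S l * ind T l ≡ ind S l
  pointwise l with lookup S l in e
  ... | false = refl
  ... | true rewrite S⊆T l e = refl

Top-⊆ : ∀ {c} {S T : Subset n} (topS : Top c S) (topT : Top c T) →
        threshold topT ≤ threshold topS → ∀ l → lookup S l ≡ true → lookup T l ≡ true
Top-⊆ {T = T} topS topT θ≤ l p with lookup T l in q
... | true  = refl
... | false = contradiction (≤-trans θ≤ (inside≥ topS l p)) (<⇒≱ (outside< topT l q))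

-- Two top sets of the same monomial are nested, so their intersection is the smaller one, and no
-- intersection of sets of these sizes can be larger.
common-maximal : ∀ {c} {S T S′ T′ : Subset n} → Top c S → Top c T →
                  ∣ S′ ∣ ≡ ∣ S ∣ → ∣ T′ ∣ ≡ ∣ T ∣ → common S′ T′ ≤ common S T
common-maximal {S = S} {T} {S′} {T′} topS topT e e′ with ≤-total (threshold topS) (threshold topT)
... | inj₁ θ≤ = subst (common S′ T′ ≤_)
  (trans e′ (sym (trans (common-comm S T) (common-⊆ T S (Top-⊆ topT topS θ≤)))))
  (≤-trans (≤-reflexive (common-comm S′ T′)) (common≤ˡ T′ S′))
... | inj₂ θ≤ = subst (common S′ T′ ≤_) (trans e (sym (common-⊆ S T (Top-⊆ topS topT θ≤))))
  (common≤ˡ S′ T′)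

rank-·-· : ∀ c (S T : Subset n) → rank ((c · squarefree T) · squarefree S)
           ≡ (rank c + totalWeight c T) + (totalWeight c S + common S T * n)
rank-·-· c S T = trans (rank-·-squarefree (c · squarefree T) S)
  (cong₂ _+_ (rank-·-squarefree c T) (totalWeight-· c S T))

-- By `rank-·-·` the rank is `rank c` plus the two total weights and `n` times the intersection
-- size. Each of these is largest at the top sets, and the weight of `T′` is strictly smaller than
-- that of `T`.
rank-double-maximal : ∀ {c} {S T S′ T′ : Subset n} → Top c S → Top c T →
  ∣ S′ ∣ ≡ ∣ S ∣ → ∣ T′ ∣ ≡ ∣ T ∣ → T′ ≢ T →
  rank ((c · squarefree T′) · squarefree S′) < rank ((c · squarefree T) · squarefree S)
rank-double-maximal {n} {c} {S} {T} {S′} {T′} topS topT e e′ T′≢T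
  with Top-maximal {S = T′} topT e′
... | inj₁ p = contradiction p T′≢T
... | inj₂ p = subst₂ _<_ (sym (rank-·-· c S′ T′)) (sym (rank-·-· c S T))
  (+-mono-<-≤ (+-monoʳ-< (rank c) p)
    (+-mono-≤ (Top-maximal-≤ {S = S′} topS e) (*-monoˡ-≤ n (common-maximal {S′ = S′} {T′} topS topT e e′))))

-- The analogue of resolving an S-pair.

Top-confluence : ∀ {b b′} {T T′ : Subset n} → Top b T → Top b′ T′ →
  b · squarefree T ≡ b′ · squarefree T′ → T ≢ T′ →
  ∃ λ c → Top c T × Top c T′ × b ≡ c · squarefree T′ × b′ ≡ c · squarefree T
Top-confluence {n} {b} {b′} {T} {T′} top top′ e T≢T′ = case ≤-total (threshold top) (threshold top′) of λ
  { (inj₁ θ≤θ′) → nested top top′ e T≢T′ θ≤θ′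
  ; (inj₂ θ′≤θ) → let c , t′ , t , p , q = nested top′ top (sym e) (T≢T′ ∘ sym) θ′≤θ
                  in c , t , t′ , q , p }
  where
  nested : ∀ {b b′} {T T′ : Subset n} (top : Top b T) (top′ : Top b′ T′) →
    b · squarefree T ≡ b′ · squarefree T′ → T ≢ T′ → threshold top ≤ threshold top′ →
    ∃ λ c → Top c T × Top c T′ × b ≡ c · squarefree T′ × b′ ≡ c · squarefree T
  nested {b} {b′} {T} {T′} top top′ e T≢T′ θ≤θ′ = c , topT , topT′ , b≡ , b′≡
    where
    θ = threshold top
    θ′ = threshold top′

    exponents : ∀ l → lookup b l + ind T l ≡ lookup b′ l + ind T′ l
    exponents l = trans (sym (lookup-·-squarefree b T l))
      (trans (cong (λ u → lookup u l) e) (lookup-·-squarefree b′ T′ l))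

    weights : ∀ l → weight b l + ind T l * n ≡ weight b′ l + ind T′ l * n
    weights l = trans (sym (weight-·-squarefree b T l))
      (trans (cong (λ u → weight u l) e) (weight-·-squarefree b′ T′ l))

    -- A letter of `T′` outside `T` would be heavier by `n` under `b` than under `b′`, although it
    -- lies below θ under `b` and at least at θ′ under `b′`.
    T′⊆T : ∀ l → lookup T′ l ≡ true → lookup T l ≡ true
    T′⊆T l p with lookup T l in q | weights l
    ... | true  | _ = refl
    ... | false | w rewrite p = contradiction (begin-strict
        weight b l                    <⟨ outside< top l q ⟩
        θ                             ≤⟨ θ≤θ′ ⟩
        θ′                            ≤⟨ inside≥ top′ l p ⟩
        weight b′ l                   ≤⟨ m≤m+n _ _ ⟩
        weight b′ l + 1 * n           ≡⟨ w ⟨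
        weight b l + 0                ≡⟨ +-identityʳ _ ⟩
        weight b l                    ∎) (<-irrefl refl)
      where open ≤-Reasoning

    -- A letter of `T` outside `T′` is heavier by `n` under `b′` than under `b`; it weighs at least
    -- θ under `b` and less than θ′ under `b′`.
    gap : θ + n < θ′
    gap with Finₚ.any? (λ l → (lookup T l Boolₚ.≟ true) ×-dec (lookup T′ l Boolₚ.≟ false))
    ... | no ∄l = contradiction (lookup-extensional same) T≢T′
      where
      same : ∀ l → lookup T l ≡ lookup T′ l
      same l with lookup T l in p | lookup T′ l in q
      ... | true  | true  = refl
      ... | false | false = refl
      ... | true  | false = contradiction (l , p , q) ∄l
      ... | false | true  = contradiction (trans (sym (T′⊆T l q)) p) λ ()
    ... | yes (l , p , q) with weights l
    ...   | w rewrite p | q = begin-strict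
        θ + n                ≤⟨ +-monoˡ-≤ n (inside≥ top l p) ⟩
        weight b l + n       ≡⟨ cong (weight b l +_) (+-identityʳ n) ⟨
        weight b l + 1 * n   ≡⟨ w ⟩
        weight b′ l + 0      ≡⟨ +-identityʳ _ ⟩
        weight b′ l          <⟨ outside< top′ l q ⟩
        θ′                   ∎
      where open ≤-Reasoning

    positive : ∀ l → lookup T′ l ≡ true → 1 ≤ lookup b l
    positive l p = n≢0⇒n>0 λ q → <-irrefl refl (begin-strict
        toℕ (opposite l)      <⟨ opposite<n l ⟩
        n                     ≤⟨ m≤n+m n θ ⟩
        θ + n                 <⟨ gap ⟩
        θ′                    ≤⟨ inside≥ top′ l p ⟩
        weight b′ l           ≡⟨ same-weight ⟨
        weight b l            ≡⟨ cong (λ a → a * n + toℕ (opposite l)) q ⟩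
        toℕ (opposite l)      ∎)
      where
      open ≤-Reasoning
      same-weight : weight b l ≡ weight b′ l
      same-weight with w ← weights l rewrite T′⊆T l p | p = +-cancelʳ-≡ (1 * n) _ _ w

    -- Divide `b` by the smaller set. By `gap` the letters of `T′` weigh more than `n`, so their
    -- exponents are positive and the division is exact.
    c : Monomial n
    c = tabulate λ l → lookup b l ∸ ind T′ l

    b≡ : b ≡ c · squarefree T′
    b≡ = lookup-extensional λ l → sym (trans (lookup-·-squarefree c T′ l)
      (trans (cong (_+ ind T′ l) (Vecₚ.lookup∘tabulate _ l)) (m∸n+n≡m (ind≤b l))))
      where
      ind≤b : ∀ l → ind T′ l ≤ lookup b l
      ind≤b l with lookup T′ l in p
      ... | true  = positive l p
      ... | false = z≤n

    b′≡ : b′ ≡ c · squarefree T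
    b′≡ = lookup-extensional λ l → +-cancelʳ-≡ (ind T′ l) _ _ (begin
      lookup b′ l + ind T′ l                        ≡⟨ exponents l ⟨
      lookup b l + ind T l                          ≡⟨ cong (λ u → lookup u l + ind T l) b≡ ⟩
      lookup (c · squarefree T′) l + ind T l        ≡⟨ cong (_+ ind T l) (lookup-·-squarefree c T′ l) ⟩
      lookup c l + ind T′ l + ind T l               ≡⟨ swap (lookup c l) (ind T′ l) (ind T l) ⟩
      lookup c l + ind T l + ind T′ l               ≡⟨ cong (_+ ind T′ l) (lookup-·-squarefree c T l) ⟨
      lookup (c · squarefree T) l + ind T′ l        ∎)
      where
      open ≡-Reasoning
      swap : ∀ a b c → a + b + c ≡ a + c + b
      swap = solve-∀

    weight-b : ∀ l → weight b l ≡ weight c l + ind T′ l * n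
    weight-b l = trans (cong (λ u → weight u l) b≡) (weight-·-squarefree c T′ l)

    weight-b′ : ∀ l → weight b′ l ≡ weight c l + ind T l * n
    weight-b′ l = trans (cong (λ u → weight u l) b′≡) (weight-·-squarefree c T l)

    topT : Top c T
    topT = record
      { threshold = θ
      ; inside≥   = above
      ; outside<  = λ l p → ≤-<-trans (≤-trans (m≤m+n _ _) (≤-reflexive (sym (weight-b l)))) (outside< top l p)
      }
      where
      -- A letter in both sets weighs at least θ′ under `b′`. It is lighter by `n` under `c`, a loss
      -- that `gap` covers.
      above : ∀ l → lookup T l ≡ true → θ ≤ weight c l
      above l p with lookup T′ l in q | weight-b l | weight-b′ l
      ... | false | w | _  = ≤-trans (inside≥ top l p) (≤-reflexive (trans w (+-identityʳ _)))
      ... | true  | _ | w′ rewrite p = +-cancelʳ-≤ (1 * n) _ _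
        (≤-trans (≤-reflexive (cong (θ +_) (+-identityʳ n)))
          (≤-trans (<⇒≤ gap) (≤-trans (inside≥ top′ l q) (≤-reflexive w′))))

    -- Passing from `b′` to `c` lowers the letters of `T`, and with them those of `T′`, by `n`;
    -- hence the shifted threshold.
    topT′ : Top c T′
    topT′ = record
      { threshold = θ′ ∸ n
      ; inside≥   = λ l p → m≤n+o⇒m∸n≤o θ′ n (≤-trans (inside≥ top′ l p)
          (≤-reflexive (trans (weight-b′ l) (trans (cong (λ t → weight c l + (if t then 1 else 0) * n) (T′⊆T l p))
            (trans (cong (weight c l +_) (+-identityʳ n)) (+-comm (weight c l) n))))))
      ; outside<  = below
      }
      where
      below : ∀ l → lookup T′ l ≡ false → weight c l < θ′ ∸ n
      below l p with lookup T l in q | weight-b′ l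
      ... | true  | w′ = m+n≤o⇒m≤o∸n (suc (weight c l)) (≤-trans
        (s≤s (≤-reflexive (trans (cong (weight c l +_) (sym (+-identityʳ n))) (sym w′)))) (outside< top′ l p))
      ... | false | _  = m+n≤o⇒m≤o∸n (suc (weight c l)) (≤-trans (+-monoˡ-≤ n
        (≤-<-trans (≤-trans (m≤m+n _ _) (≤-reflexive (sym (weight-b l)))) (outside< top l q))) (<⇒≤ gap))

-- Sorting letters and the Garsia–Stanton monomials

sum-≤-below : ∀ m (f : Fin n → ℕ) → (∀ l → f l ≤ 1) → (∀ l → m ≤ toℕ l → f l ≡ 0) → sum f ≤ m
sum-≤-below {zero}  m       f f≤1 f≡0 = z≤n
sum-≤-below {suc n} zero    f f≤1 f≡0 rewrite f≡0 zero z≤n =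
  sum-≤-below zero (f ∘ suc) (f≤1 ∘ suc) (λ l _ → f≡0 (suc l) z≤n)
sum-≤-below {suc n} (suc m) f f≤1 f≡0 =
  +-mono-≤ (f≤1 zero) (sum-≤-below m (f ∘ suc) (f≤1 ∘ suc) (λ l p → f≡0 (suc l) (s≤s p)))

sum-≥-below : ∀ m (f : Fin n → ℕ) → m ≤ n → (∀ l → toℕ l < m → 1 ≤ f l) → m ≤ sum f
sum-≥-below         zero    f m≤n       f≥1 = z≤n
sum-≥-below {suc n} (suc m) f (s≤s m≤n) f≥1 =
  +-mono-≤ (f≥1 zero (s≤s z≤n)) (sum-≥-below m (f ∘ suc) m≤n (λ l p → f≥1 (suc l) (s≤s p)))

sum-zero : (f : Fin n → ℕ) → (∀ l → f l ≡ 0) → sum f ≡ 0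
sum-zero f f≡0 = n≤0⇒n≡0 (sum-≤-below 0 f (λ l → ≤-trans (≤-reflexive (f≡0 l)) z≤n) (λ l _ → f≡0 l))

sum-at : ∀ (f : Fin n → ℕ) p → (∀ l → l ≢ p → f l ≡ 0) → sum f ≡ f p
sum-at f zero    f≡0 =
  trans (cong (f zero +_) (sum-zero (f ∘ suc) (λ l → f≡0 (suc l) λ ()))) (+-identityʳ _)
sum-at f (suc p) f≡0 rewrite f≡0 zero (λ ()) =
  sum-at (f ∘ suc) p (λ l l≢p → f≡0 (suc l) (l≢p ∘ Finₚ.suc-injective))

injective⇒surjective : (f : Fin n → Fin n) → (∀ {i j} → f i ≡ f j → i ≡ j) → ∀ p → ∃ λ l → f l ≡ p
injective⇒surjective {suc n} f inj p with Finₚ.any? (λ l → f l Finₚ.≟ p)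
... | yes q = q
... | no ∄l with i , j , i<j , e ← Finₚ.pigeonhole (n<1+n n) (λ l → punchOut {i = p} {f l} (λ p≡ → ∄l (l , sym p≡)))
  = contradiction (inj (Finₚ.punchOut-injective {i = p} _ _ e)) (Finₚ.<⇒≢ i<j)

successor? : (p : Fin n) → (∃ λ q → toℕ q ≡ suc (toℕ p)) ⊎ (∀ q → ¬ p Fin.< q)
successor? {n} p with suc (toℕ p) <? n
... | yes p<n = inj₁ (fromℕ< p<n , Finₚ.toℕ-fromℕ< p<n)
... | no  p≮n = inj₂ λ q p<q → p≮n (≤-<-trans p<q (Finₚ.toℕ<n q))

antitone-from-steps : (f : Fin n → ℕ) → (∀ p q → toℕ q ≡ suc (toℕ p) → f q ≤ f p) →
                      ∀ p q → p Fin.≤ q → f q ≤ f p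
antitone-from-steps {n} f step p q p≤q = go p (>-wellFounded p) p≤q
  where
  go : ∀ p → Acc Fin._>_ p → p Fin.≤ q → f q ≤ f p
  go p (acc rec) p≤q with m≤n⇒m<n∨m≡n p≤q
  ... | inj₂ e = ≤-reflexive (cong f (sym (Finₚ.toℕ-injective e)))
  ... | inj₁ p<q with successor? p
  ...   | inj₂ last    = contradiction p<q (last q)
  ...   | inj₁ (r , e) = ≤-trans (go r (rec (≤-reflexive (sym e))) (≤-trans (≤-reflexive e) p<q)) (step p r e)

module _ (a : Monomial n) where

  Sorted : Permutation′ n → Set
  Sorted π = ∀ {p q} → p Fin.< q → weight a (π ⟨$⟩ʳ q) < weight a (π ⟨$⟩ʳ p)

  private
    heavier : Fin n → Fin n → ℕ
    heavier l m = if does (weight a l <? weight a m) then 1 else 0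

    heavier≤1 : ∀ l m → heavier l m ≤ 1
    heavier≤1 l m with does (weight a l <? weight a m)
    ... | true  = ≤-refl
    ... | false = z≤n

    heavier-yes : ∀ {l m} → weight a l < weight a m → heavier l m ≡ 1
    heavier-yes {l} {m} p rewrite dec-true (weight a l <? weight a m) p = refl

    heavier-no : ∀ {l m} → ¬ weight a l < weight a m → heavier l m ≡ 0
    heavier-no {l} {m} ¬p rewrite dec-false (weight a l <? weight a m) ¬p = refl

    -- The place of `l` in the sorted word is the number of heavier letters; it determines `l`
    -- because weights are distinct.
    position : Fin n → ℕ
    position l = sum (heavier l)

    position<n : ∀ l → position l < n
    position<n l = <-≤-trans
      (sum-mono-< (heavier l) (λ _ → 1) (heavier≤1 l) l
        (≤-reflexive (cong suc (heavier-no {l} {l} (<-irrefl refl)))))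
      (sum-≤-below n (λ _ → 1) (λ _ → ≤-refl) (λ m n≤m → contradiction (Finₚ.toℕ<n m) (≤⇒≯ n≤m)))

    position-antitone : ∀ {l m} → weight a l < weight a m → position m < position l
    position-antitone {l} {m} l<m = sum-mono-< (heavier m) (heavier l) pointwise m
      (subst₂ _<_ (sym (heavier-no {m} {m} (<-irrefl refl))) (sym (heavier-yes l<m)) ≤-refl)
      where
      pointwise : ∀ k → heavier m k ≤ heavier l k
      pointwise k = case weight a m <? weight a k of λ
        { (yes m<k) → ≤-reflexive (trans (heavier-yes m<k) (sym (heavier-yes (<-trans l<m m<k))))
        ; (no  m≮k) → ≤-trans (≤-reflexive (heavier-no m≮k)) z≤n }

    σ : Fin n → Fin n
    σ l = fromℕ< (position<n l)

    toℕ-σ : ∀ l → toℕ (σ l) ≡ position l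
    toℕ-σ l = Finₚ.toℕ-fromℕ< (position<n l)

    σ-injective : ∀ {l m} → σ l ≡ σ m → l ≡ m
    σ-injective {l} {m} e with <-cmp (weight a l) (weight a m)
    ... | tri≈ _ p _ = weight-injective a p
    ... | tri< p _ _ = contradiction (trans (sym (toℕ-σ m)) (trans (cong toℕ (sym e)) (toℕ-σ l)))
                         (<⇒≢ (position-antitone p))
    ... | tri> _ _ p = contradiction (trans (sym (toℕ-σ l)) (trans (cong toℕ e) (toℕ-σ m)))
                         (<⇒≢ (position-antitone p))

    σ⁻¹ : ∀ p → ∃ λ l → σ l ≡ p
    σ⁻¹ = injective⇒surjective σ σ-injective

  sort : ∃ Sorted
  sort = permutation (proj₁ ∘ σ⁻¹) σ (λ l → σ-injective (proj₂ (σ⁻¹ (σ l)))) (proj₂ ∘ σ⁻¹)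
       , λ {p} {q} p<q → ≰⇒> λ wp≤wq → case m≤n⇒m<n∨m≡n wp≤wq of λ
    { (inj₁ wp<wq) → <-asym p<q (subst₂ _<_
        (trans (sym (toℕ-σ _)) (cong toℕ (proj₂ (σ⁻¹ q))))
        (trans (sym (toℕ-σ _)) (cong toℕ (proj₂ (σ⁻¹ p)))) (position-antitone wp<wq))
    ; (inj₂ wp≡wq) → Finₚ.<⇒≢ p<q (trans (sym (proj₂ (σ⁻¹ p)))
        (trans (cong σ (weight-injective a wp≡wq)) (proj₂ (σ⁻¹ q)))) }

  Sorted-≤ : ∀ {π p q} → Sorted π → p Fin.≤ q → weight a (π ⟨$⟩ʳ q) ≤ weight a (π ⟨$⟩ʳ p)
  Sorted-≤ {π} sorted p≤q with m≤n⇒m<n∨m≡n p≤q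
  ... | inj₁ p<q = <⇒≤ (sorted p<q)
  ... | inj₂ e   = ≤-reflexive (cong (λ r → weight a (π ⟨$⟩ʳ r)) (sym (Finₚ.toℕ-injective e)))

  heaviest : ℕ → Subset n
  heaviest θ = tabulate λ l → does (θ ≤? weight a l)

  heaviest-yes : ∀ {θ l} → θ ≤ weight a l → lookup (heaviest θ) l ≡ true
  heaviest-yes {θ} {l} p = trans (Vecₚ.lookup∘tabulate _ l) (dec-true (θ ≤? weight a l) p)

  heaviest-no : ∀ {θ l} → ¬ θ ≤ weight a l → lookup (heaviest θ) l ≡ false
  heaviest-no {θ} {l} ¬p = trans (Vecₚ.lookup∘tabulate _ l) (dec-false (θ ≤? weight a l) ¬p)

  heaviest-yes⁻¹ : ∀ {θ l} → lookup (heaviest θ) l ≡ true → θ ≤ weight a l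
  heaviest-yes⁻¹ {θ} {l} e with θ ≤? weight a l
  ... | yes p = p
  ... | no ¬p = contradiction (trans (sym e) (heaviest-no ¬p)) λ ()

  heaviest-no⁻¹ : ∀ {θ l} → lookup (heaviest θ) l ≡ false → weight a l < θ
  heaviest-no⁻¹ {θ} {l} e with θ ≤? weight a l
  ... | no ¬p = ≰⇒> ¬p
  ... | yes p = contradiction (trans (sym (heaviest-yes p)) e) λ ()

  ∣∣≡sum-permuted : ∀ (π : Permutation′ n) (T : Subset n) → ∣ T ∣ ≡ sum (λ p → ind T (π ⟨$⟩ʳ p))
  ∣∣≡sum-permuted π T = trans (∣∣≡sum T) (sum-permute (ind T) π)

  module _ (π : Permutation′ n) (sorted : Sorted π) where

    private
      W : Fin n → ℕ
      W p = weight a (π ⟨$⟩ʳ p)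

    -- Weights decrease strictly along the word, so exactly the positions 0, ..., p hold letters of
    -- weight at least `W p`.
    ∣heaviest∣ : ∀ p → ∣ heaviest (W p) ∣ ≡ suc (toℕ p)
    ∣heaviest∣ p = trans (∣∣≡sum-permuted π (heaviest (W p))) (≤-antisym
      (sum-≤-below (suc (toℕ p)) _ (λ q → ind≤1 (heaviest (W p)) (π ⟨$⟩ʳ q)) λ q p<q →
        cong (if_then 1 else 0) (heaviest-no (<⇒≱ (sorted p<q))))
      (sum-≥-below (suc (toℕ p)) _ (Finₚ.toℕ<n p) λ q q≤p →
        ≤-reflexive (sym (cong (if_then 1 else 0) (heaviest-yes (Sorted-≤ {π} sorted (s≤s⁻¹ q≤p)))))))

  Top-exists : ∀ j → 1 ≤ j → j ≤ n → ∃ λ T → Top a T × ∣ T ∣ ≡ j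
  Top-exists (suc j) _ j<n with π , sorted ← sort =
    heaviest θ
    , record { threshold = θ ; inside≥ = λ _ → heaviest-yes⁻¹ ; outside< = λ _ → heaviest-no⁻¹ }
    , trans (∣heaviest∣ π sorted (fromℕ< j<n)) (cong suc (Finₚ.toℕ-fromℕ< j<n))
    where
    θ = weight a (π ⟨$⟩ʳ fromℕ< j<n)

-- a is the leading monomial of a multiple of some e_d with d > n - k.

ElementaryLead : ∀ n k → Pred (Monomial n) 0ℓ
ElementaryLead n k a = ∃₂ λ b T → Top b T × n ∸ k < ∣ T ∣ × a ≡ b · squarefree T

PowerDivides : ∀ n k → Pred (Monomial n) 0ℓ
PowerDivides n k a = ∃ λ l → k ≤ lookup a l

powerDivides? : ∀ k → Decidable (PowerDivides n k)
powerDivides? k a = Finₚ.any? λ l → k ≤? lookup a l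

module _ (a : Monomial n) (π : Permutation′ n) where

  private
    W : Fin n → ℕ
    W p = weight a (π ⟨$⟩ʳ p)

  -- Lowering the exponents of the letters up to position p by one is possible and
  -- keeps them ahead of the later letters.

  Gap : Fin n → Set
  Gap p = n ≤ W p × ∀ q → p Fin.< q → W q + n < W p

  gap? : Decidable Gap
  gap? p = (n ≤? W p) ×-dec Finₚ.all? λ q → (p Finₚ.<? q) →-dec (W q + n <? W p)

  module _ (sorted : Sorted a π) (k : ℕ) where

    -- Divide `a` by the p + 1 heaviest letters. A weight of at least `n` means a positive exponent,
    -- so this is possible, and since the later letters are lighter by more than `n`, the divided
    -- letters stay on top.
    Gap⇒ElementaryLead : ∀ p → n ∸ k ≤ toℕ p → Gap p → ElementaryLead n k a
    Gap⇒ElementaryLead p n∸k≤p (n≤Wp , below) =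
      b , T , top , <-≤-trans (s≤s n∸k≤p) (≤-reflexive (sym (∣heaviest∣ a π sorted p))) , a≡
      where
      T = heaviest a (W p)

      b : Monomial n
      b = tabulate λ l → lookup a l ∸ ind T l

      ind≤a : ∀ l → ind T l ≤ lookup a l
      ind≤a l with lookup T l in t
      ... | false = z≤n
      ... | true  = n≢0⇒n>0 λ a≡0 → <⇒≱ (opposite<n l) (≤-trans n≤Wp (≤-trans (heaviest-yes⁻¹ a t)
                      (≤-reflexive (cong (λ e → e * n + toℕ (opposite l)) a≡0))))

      a≡ : a ≡ b · squarefree T
      a≡ = lookup-extensional λ l → sym (trans (lookup-·-squarefree b T l)
        (trans (cong (_+ ind T l) (Vecₚ.lookup∘tabulate _ l)) (m∸n+n≡m (ind≤a l))))

      weight-a : ∀ l → weight a l ≡ weight b l + ind T l * n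
      weight-a l = trans (cong (λ u → weight u l) a≡) (weight-·-squarefree b T l)

      top : Top b T
      top = record
        { threshold = W p ∸ n
        ; inside≥   = λ l t → m≤n+o⇒m∸n≤o (W p) n (≤-trans (heaviest-yes⁻¹ a t) (≤-reflexive
            (trans (weight-a l) (trans (cong (λ e → weight b l + (if e then 1 else 0) * n) t)
              (trans (cong (weight b l +_) (+-identityʳ n)) (+-comm (weight b l) n))))))
        ; outside<  = λ l t → m+n≤o⇒m≤o∸n (suc (weight b l)) (≤-trans
            (s≤s (+-monoˡ-≤ n (≤-trans (m≤m+n _ _) (≤-reflexive (sym (weight-a l))))))
            (subst (λ m → weight a m + n < W p) (inverseʳ π) (below (π ⟨$⟩ˡ l) (later l t))))
        }
        where
        later : ∀ l → lookup T l ≡ false → p Fin.< π ⟨$⟩ˡ l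
        later l t = ≰⇒> λ q≤p → <⇒≱ (heaviest-no⁻¹ a t)
          (subst (λ m → W p ≤ weight a m) (inverseʳ π) (Sorted-≤ a {π} sorted q≤p))

    -- In `a` the letters of `T` weigh at least the threshold plus `n`, and all others less than the
    -- threshold. As `T` has more than n - k letters, one of them stands at a position from n - k
    -- on, and the last such position is a gap.
    ElementaryLead⇒Gap : ElementaryLead n k a → ∃ λ p → n ∸ k ≤ toℕ p × Gap p
    ElementaryLead⇒Gap (b , T , top , size , a≡)
      with Finₚ.any? (λ p → (n ∸ k ≤? toℕ p) ×-dec (lookup T (π ⟨$⟩ʳ p) Boolₚ.≟ true))
    ... | no ∄p = contradiction size (≤⇒≯ (≤-trans (≤-reflexive (∣∣≡sum-permuted a π T))
            (sum-≤-below (n ∸ k) _ (λ p → ind≤1 T (π ⟨$⟩ʳ p)) absent)))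
      where
      absent : ∀ p → n ∸ k ≤ toℕ p → ind T (π ⟨$⟩ʳ p) ≡ 0
      absent p n∸k≤p with lookup T (π ⟨$⟩ʳ p) in t
      ... | false = refl
      ... | true  = contradiction (p , n∸k≤p , t) ∄p
    ... | yes (p , n∸k≤p , t) = go p (>-wellFounded p) n∸k≤p t
      where
      weight-a : ∀ l → weight a l ≡ weight b l + ind T l * n
      weight-a l = trans (cong (λ u → weight u l) a≡) (weight-·-squarefree b T l)

      inside : ∀ l → lookup T l ≡ true → threshold top + n ≤ weight a l
      inside l t = ≤-trans (+-monoˡ-≤ n (inside≥ top l t)) (≤-reflexive (sym (trans (weight-a l)
        (trans (cong (λ e → weight b l + (if e then 1 else 0) * n) t)
               (cong (weight b l +_) (+-identityʳ n))))))

      outside : ∀ l → lookup T l ≡ false → weight a l < threshold top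
      outside l t = ≤-<-trans (≤-reflexive (trans (weight-a l)
        (trans (cong (λ e → weight b l + (if e then 1 else 0) * n) t) (+-identityʳ _)))) (outside< top l t)

      go : ∀ p → Acc Fin._>_ p → n ∸ k ≤ toℕ p → lookup T (π ⟨$⟩ʳ p) ≡ true →
           ∃ λ p → n ∸ k ≤ toℕ p × Gap p
      go p (acc rec) n∸k≤p t
        with Finₚ.any? (λ q → (p Finₚ.<? q) ×-dec (lookup T (π ⟨$⟩ʳ q) Boolₚ.≟ true))
      ... | yes (q , p<q , t′) = go q (rec p<q) (≤-trans n∸k≤p (<⇒≤ p<q)) t′
      ... | no ∄q = p , n∸k≤p , ≤-trans (m≤n+m n (threshold top)) (inside _ t) , below
        where
        below : ∀ q → p Fin.< q → W q + n < W p
        below q p<q with lookup T (π ⟨$⟩ʳ q) in t′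
        ... | true  = contradiction (q , p<q , t′) ∄q
        ... | false = <-≤-trans (+-monoˡ-< n (outside _ t′)) (inside _ t)

  elementaryLead? : Sorted a π → ∀ k → Dec (ElementaryLead n k a)
  elementaryLead? sorted k with Finₚ.any? (λ p → (n ∸ k ≤? toℕ p) ×-dec gap? p)
  ... | yes (p , n∸k≤p , gap) = yes (Gap⇒ElementaryLead sorted k p n∸k≤p gap)
  ... | no ∄gap               = no (∄gap ∘ ElementaryLead⇒Gap sorted k)

-- Exponents along the word of a permutation.

lookup-∏ : ∀ {A : Set} (is : List A) (f : A → Monomial n) l →
           lookup (∏ is f) l ≡ foldr (λ i s → lookup (f i) l + s) 0 is
lookup-∏ []       f l = Vecₚ.lookup-replicate l 0
lookup-∏ (i ∷ is) f l = trans (lookup-· (f i) (∏ is f) l) (cong (lookup (f i) l +_) (lookup-∏ is f l))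

foldr-tabulate : ∀ {A : Set} (φ : A → ℕ) (g : Fin n → A) →
                 foldr (λ i s → φ i + s) 0 (List.tabulate g) ≡ sum (φ ∘ g)
foldr-tabulate {zero}  φ g = refl
foldr-tabulate {suc n} φ g = cong (φ (g zero) +_) (foldr-tabulate φ (g ∘ suc))

foldr-filter-tabulate : ∀ {A : Set} {P : Pred A 0ℓ} (P? : Decidable P) (φ : A → ℕ) (g : Fin n → A) →
  foldr (λ i s → φ i + s) 0 (filter P? (List.tabulate g))
  ≡ sum (λ i → if does (P? (g i)) then φ (g i) else 0)
foldr-filter-tabulate {zero}  P? φ g = refl
foldr-filter-tabulate {suc n} P? φ g with does (P? (g zero))
... | true  = cong (φ (g zero) +_) (foldr-filter-tabulate P? φ (g ∘ suc))
... | false = foldr-filter-tabulate P? φ (g ∘ suc)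

length≡foldr : ∀ {A : Set} (xs : List A) → length xs ≡ foldr (λ _ s → 1 + s) 0 xs
length≡foldr []       = refl
length≡foldr (_ ∷ xs) = cong suc (length≡foldr xs)

lookup-x-≡ : (l : Fin n) → lookup (x l) l ≡ 1
lookup-x-≡ l = Vecₚ.lookup∘update l 1ᵐ 1

lookup-x-≢ : {l m : Fin n} → l ≢ m → lookup (x m) l ≡ 0
lookup-x-≢ {l = l} l≢m = trans (Vecₚ.lookup∘update′ l≢m 1ᵐ 1) (Vecₚ.lookup-replicate l 0)

module _ (π : Permutation′ n) where

  private
    π-injective : ∀ {p q} → π ⟨$⟩ʳ p ≡ π ⟨$⟩ʳ q → p ≡ q
    π-injective {p} {q} e = trans (sym (Inverse.strictlyInverseʳ π p))
      (trans (cong (π ⟨$⟩ˡ_) e) (Inverse.strictlyInverseʳ π q))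

  drop : Fin n → ℕ
  drop p = if does (isDescent? π p) then 1 else 0

  -- The number of descents at positions ≥ p. The nested conditionals are the form in which
  -- `foldr-filter-tabulate` produces it from `gs`.
  descentsFrom : Fin n → ℕ
  descentsFrom p = sum λ i → if does (isDescent? π i) then (if does (p Finₚ.≤? i) then 1 else 0) else 0

  des≡sum : des π ≡ sum drop
  des≡sum = trans (length≡foldr (Des π)) (foldr-filter-tabulate (isDescent? π) (λ _ → 1) id)

  descentsFrom≤des : ∀ p → descentsFrom p ≤ des π
  descentsFrom≤des p = ≤-trans (sum-mono-≤ _ drop pointwise) (≤-reflexive (sym des≡sum))
    where
    pointwise : ∀ i → (if does (isDescent? π i) then (if does (p Finₚ.≤? i) then 1 else 0) else 0) ≤ drop i
    pointwise i with does (isDescent? π i) | does (p Finₚ.≤? i)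
    ... | true  | true  = ≤-refl
    ... | true  | false = z≤n
    ... | false | _     = z≤n

  -- The letter at position `p` occurs once in the prefix ending at `i` if p ≤ i, and otherwise not
  -- at all.
  lookup-gs : ∀ p → lookup (gs π) (π ⟨$⟩ʳ p) ≡ descentsFrom p
  lookup-gs p = begin
    lookup (gs π) (π ⟨$⟩ʳ p)
      ≡⟨ lookup-∏ (Des π) prefix (π ⟨$⟩ʳ p) ⟩
    foldr (λ i s → lookup (prefix i) (π ⟨$⟩ʳ p) + s) 0 (Des π)
      ≡⟨ foldr-filter-tabulate (isDescent? π) (λ i → lookup (prefix i) (π ⟨$⟩ʳ p)) id ⟩
    sum (λ i → if does (isDescent? π i) then lookup (prefix i) (π ⟨$⟩ʳ p) else 0)
      ≡⟨ sum-cong-≗ (λ i → cong (if does (isDescent? π i) then_else 0) (lookup-prefix i)) ⟩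
    descentsFrom p ∎
    where
    open ≡-Reasoning
    prefix : Fin n → Monomial n
    prefix i = ∏ (filter (Finₚ._≤? i) (allFin n)) λ j → x (π ⟨$⟩ʳ j)

    lookup-prefix : ∀ i → lookup (prefix i) (π ⟨$⟩ʳ p) ≡ (if does (p Finₚ.≤? i) then 1 else 0)
    lookup-prefix i = trans (lookup-∏ (filter (Finₚ._≤? i) (allFin n)) _ (π ⟨$⟩ʳ p))
      (trans (foldr-filter-tabulate (Finₚ._≤? i) (λ j → lookup (x (π ⟨$⟩ʳ j)) (π ⟨$⟩ʳ p)) id)
      (trans (sum-at _ p off) at))
      where
      off : ∀ j → j ≢ p → (if does (j Finₚ.≤? i) then lookup (x (π ⟨$⟩ʳ j)) (π ⟨$⟩ʳ p) else 0) ≡ 0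
      off j j≢p rewrite lookup-x-≢ {l = π ⟨$⟩ʳ p} {π ⟨$⟩ʳ j} (λ e → j≢p (sym (π-injective e)))
        with does (j Finₚ.≤? i)
      ... | true  = refl
      ... | false = refl
      at : (if does (p Finₚ.≤? i) then lookup (x (π ⟨$⟩ʳ p)) (π ⟨$⟩ʳ p) else 0)
           ≡ (if does (p Finₚ.≤? i) then 1 else 0)
      at rewrite lookup-x-≡ (π ⟨$⟩ʳ p) = refl

  descentsFrom-first : ∀ p → (∀ q → p Fin.≤ q) → descentsFrom p ≡ des π
  descentsFrom-first p first = trans (sum-cong-≗ pointwise) (sym des≡sum)
    where
    pointwise : ∀ i → (if does (isDescent? π i) then (if does (p Finₚ.≤? i) then 1 else 0) else 0) ≡ drop i
    pointwise i rewrite dec-true (p Finₚ.≤? i) (first i) = refl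

  descentsFrom-last : ∀ p → (∀ q → ¬ p Fin.< q) → descentsFrom p ≡ 0
  descentsFrom-last p last = sum-zero _ pointwise
    where
    pointwise : ∀ i → (if does (isDescent? π i) then (if does (p Finₚ.≤? i) then 1 else 0) else 0) ≡ 0
    pointwise i with isDescent? π i
    ... | no  _           = refl
    ... | yes (j , e , _) = cong (if_then 1 else 0) (dec-false (p Finₚ.≤? i) λ p≤i →
      last j (≤-trans (s≤s p≤i) (≤-reflexive (sym e))))

  descentsFrom-step : ∀ p q → toℕ q ≡ suc (toℕ p) → descentsFrom p ≡ drop p + descentsFrom q
  descentsFrom-step p q e = begin
    descentsFrom p
      ≡⟨ sum-cong-≗ pointwise ⟩
    sum (λ i → only i + (if does (isDescent? π i) then (if does (q Finₚ.≤? i) then 1 else 0) else 0))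
      ≡⟨ ∑-distrib-+ only _ ⟩
    sum only + descentsFrom q
      ≡⟨ cong (_+ descentsFrom q) (trans (sum-at only p off) at) ⟩
    drop p + descentsFrom q ∎
    where
    open ≡-Reasoning
    only : Fin n → ℕ
    only i = if does (i Finₚ.≟ p) then drop i else 0

    off : ∀ i → i ≢ p → only i ≡ 0
    off i i≢p rewrite dec-false (i Finₚ.≟ p) i≢p = refl

    at : only p ≡ drop p
    at rewrite dec-true (p Finₚ.≟ p) refl = refl

    split : ∀ i → (if does (p Finₚ.≤? i) then 1 else 0)
            ≡ (if does (i Finₚ.≟ p) then 1 else 0) + (if does (q Finₚ.≤? i) then 1 else 0)
    split i with <-cmp (toℕ p) (toℕ i)
    ... | tri< p<i p≢i _ rewrite dec-true (p Finₚ.≤? i) (<⇒≤ p<i)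
                               | dec-false (i Finₚ.≟ p) (λ i≡p → p≢i (cong toℕ (sym i≡p)))
                               | dec-true (q Finₚ.≤? i) (≤-trans (≤-reflexive e) p<i) = refl
    ... | tri≈ _ p≡i _ rewrite dec-true (p Finₚ.≤? i) (≤-reflexive p≡i)
                             | dec-true (i Finₚ.≟ p) (Finₚ.toℕ-injective (sym p≡i))
                             | dec-false (q Finₚ.≤? i) (λ q≤i → <-irrefl p≡i (≤-trans (≤-reflexive (sym e)) q≤i)) = refl
    ... | tri> _ p≢i i<p rewrite dec-false (p Finₚ.≤? i) (<⇒≱ i<p)
                               | dec-false (i Finₚ.≟ p) (λ i≡p → p≢i (cong toℕ (sym i≡p)))
                               | dec-false (q Finₚ.≤? i) (λ q≤i → <-asym i<p (≤-trans (≤-reflexive (sym e)) q≤i)) = refl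

    pointwise : ∀ i → (if does (isDescent? π i) then (if does (p Finₚ.≤? i) then 1 else 0) else 0)
                ≡ only i + (if does (isDescent? π i) then (if does (q Finₚ.≤? i) then 1 else 0) else 0)
    pointwise i with does (isDescent? π i) | split i
    ... | true  | s = s
    ... | false | _ with does (i Finₚ.≟ p)
    ...   | true  = refl
    ...   | false = refl

  drop-cases : ∀ p q → toℕ q ≡ suc (toℕ p) →
    (drop p ≡ 1 × toℕ (opposite (π ⟨$⟩ʳ p)) < toℕ (opposite (π ⟨$⟩ʳ q))) ⊎
    (drop p ≡ 0 × toℕ (opposite (π ⟨$⟩ʳ q)) < toℕ (opposite (π ⟨$⟩ʳ p)))
  drop-cases p q e with isDescent? π p
  ... | yes (r , e′ , πr<πp) with refl ← Finₚ.toℕ-injective {i = q} {r} (trans e (sym e′)) =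
    inj₁ (refl , opposite-antitone πr<πp)
  ... | no ¬descent = inj₂ (refl , opposite-antitone (≤∧≢⇒< (≮⇒≥ λ q<p → ¬descent (q , e , q<p))
      λ e′ → <⇒≢ (≤-reflexive (sym e)) (cong toℕ (π-injective (Finₚ.toℕ-injective e′)))))

  module _ (a : Monomial n) (p q : Fin n) (succ : toℕ q ≡ suc (toℕ p)) where

    private
      A : Fin n → ℕ
      A r = lookup a (π ⟨$⟩ʳ r)

      h : Fin n → ℕ
      h r = toℕ (opposite (π ⟨$⟩ʳ r))

    -- Ties go to the smaller letter. At a descent this is the letter at `q`, so the letter at `p`
    -- comes first only with a strictly larger exponent; at an ascent an equal exponent suffices.
    weight-<⇒exponent : weight a (π ⟨$⟩ʳ q) < weight a (π ⟨$⟩ʳ p) → A q + drop p ≤ A p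
    weight-<⇒exponent w with drop-cases p q succ
    ... | inj₂ (d , _)     rewrite d | +-identityʳ (A q) = quotient-≤ _ _ (opposite<n (π ⟨$⟩ʳ p)) (<⇒≤ w)
    ... | inj₁ (d , hp<hq) rewrite d | +-comm (A q) 1    = ≰⇒> λ Ap≤Aq → <⇒≱ w
      (+-mono-≤ (*-monoˡ-≤ n Ap≤Aq) (<⇒≤ hp<hq))

    exponent⇒weight-< : A q + drop p ≤ A p → weight a (π ⟨$⟩ʳ q) < weight a (π ⟨$⟩ʳ p)
    exponent⇒weight-< le with drop-cases p q succ
    ... | inj₂ (d , hq<hp) rewrite d | +-identityʳ (A q) = +-mono-≤-< (*-monoˡ-≤ n le) hq<hp
    ... | inj₁ (d , _)     rewrite d | +-comm (A q) 1    = begin-strict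
      A q * n + h q      <⟨ +-monoʳ-< (A q * n) (opposite<n (π ⟨$⟩ʳ q)) ⟩
      A q * n + n        ≡⟨ +-comm (A q * n) n ⟩
      suc (A q) * n      ≤⟨ *-monoˡ-≤ n le ⟩
      A p * n            ≤⟨ m≤m+n _ _ ⟩
      A p * n + h p      ∎
      where open ≤-Reasoning

    private
      shift : ∀ a n h → a * n + h + n ≡ suc a * n + h
      shift = solve-∀

    -- Adding `n` to a weight amounts to raising the exponent by one. Hence the absence of a gap
    -- bounds the fall of the exponents from above by the same `drop p` that sortedness imposes from
    -- below.
    weight-≤⇒exponent : weight a (π ⟨$⟩ʳ p) ≤ weight a (π ⟨$⟩ʳ q) + n → A p ≤ A q + drop p
    weight-≤⇒exponent w with drop-cases p q succ | ≤-trans w (≤-reflexive (shift (A q) n (h q)))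
    ... | inj₁ (d , _)     | w′ rewrite d | +-comm (A q) 1 = quotient-≤ _ _ (opposite<n (π ⟨$⟩ʳ q)) w′
    ... | inj₂ (d , hq<hp) | w′ rewrite d | +-identityʳ (A q) = s≤s⁻¹ (≰⇒> λ Aq<Ap → <⇒≱ hq<hp
      (+-cancelˡ-≤ (suc (A q) * n) _ _ (≤-trans (+-monoˡ-≤ (h p) (*-monoˡ-≤ n Aq<Ap)) w′)))

    exponent⇒weight-≤ : A p ≤ A q + drop p → weight a (π ⟨$⟩ʳ p) ≤ weight a (π ⟨$⟩ʳ q) + n
    exponent⇒weight-≤ le with drop-cases p q succ
    ... | inj₁ (d , hp<hq) rewrite d | +-comm (A q) 1 =
      ≤-trans (+-mono-≤ (*-monoˡ-≤ n le) (<⇒≤ hp<hq)) (≤-reflexive (sym (shift (A q) n (h q))))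
    ... | inj₂ (d , _)     rewrite d | +-identityʳ (A q) = begin
      A p * n + h p        ≤⟨ +-mono-≤ (*-monoˡ-≤ n le) (<⇒≤ (opposite<n (π ⟨$⟩ʳ p))) ⟩
      A q * n + n          ≤⟨ +-monoˡ-≤ n (m≤m+n (A q * n) (h q)) ⟩
      A q * n + h q + n    ∎
      where open ≤-Reasoning

  module _ {m : ℕ} (m≤n : m ≤ n) (i : Fin m → ℕ) where

    tail : Monomial n
    tail = ∏ (allFin m) λ a → x (π ⟨$⟩ʳ inject≤ a m≤n) ^ i a

    private
      lookup-tail : ∀ p → lookup tail (π ⟨$⟩ʳ p)
                    ≡ sum (λ a → i a * lookup (x (π ⟨$⟩ʳ inject≤ a m≤n)) (π ⟨$⟩ʳ p))
      lookup-tail p = trans (lookup-∏ (allFin m) _ (π ⟨$⟩ʳ p)) (trans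
        (foldr-tabulate (λ a → lookup (x (π ⟨$⟩ʳ inject≤ a m≤n) ^ i a) (π ⟨$⟩ʳ p)) id)
        (sum-cong-≗ λ a → Vecₚ.lookup-map (π ⟨$⟩ʳ p) (i a *_) (x (π ⟨$⟩ʳ inject≤ a m≤n))))

      off : ∀ {p} a → inject≤ a m≤n ≢ p → i a * lookup (x (π ⟨$⟩ʳ inject≤ a m≤n)) (π ⟨$⟩ʳ p) ≡ 0
      off a ne rewrite lookup-x-≢ (λ e → ne (sym (π-injective e))) = *-zeroʳ (i a)

    lookup-tail-head : ∀ a → lookup tail (π ⟨$⟩ʳ inject≤ a m≤n) ≡ i a
    lookup-tail-head a = trans (lookup-tail (inject≤ a m≤n)) (trans
      (sum-at _ a λ b b≢a → off b (b≢a ∘ Finₚ.inject≤-injective m≤n m≤n b a))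
      (trans (cong (i a *_) (lookup-x-≡ (π ⟨$⟩ʳ inject≤ a m≤n))) (*-identityʳ (i a))))

    lookup-tail-zero : ∀ p → m ≤ toℕ p → lookup tail (π ⟨$⟩ʳ p) ≡ 0
    lookup-tail-zero p m≤p = trans (lookup-tail p) (sum-zero _ λ a → off a λ e →
      <⇒≱ (Finₚ.toℕ<n a) (≤-trans m≤p (≤-reflexive (trans (cong toℕ (sym e)) (Finₚ.toℕ-inject≤ a m≤n)))))

head? : ∀ {m} (m≤n : m ≤ n) (p : Fin n) → (∃ λ a → p ≡ inject≤ a m≤n) ⊎ m ≤ toℕ p
head? {m = m} m≤n p with toℕ p <? m
... | no  p≮m = inj₂ (≮⇒≥ p≮m)
... | yes p<m = inj₁ (fromℕ< p<m , Finₚ.toℕ-injective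
  (sym (trans (Finₚ.toℕ-inject≤ (fromℕ< p<m) m≤n) (Finₚ.toℕ-fromℕ< p<m))))

-- Garsia-Stanton monomials as the complement of the leading monomials.

module _ {n k : ℕ} (a : Monomial n) (a∈GS : GS n k a) where

  private
    π : Permutation′ n
    π = proj₁ a∈GS

    des<k : des π < k
    des<k = proj₁ (proj₂ a∈GS)

    i : Fin (n ∸ k) → ℕ
    i = proj₁ (proj₂ (proj₂ a∈GS))

    i<k∸des : ∀ p → i p < k ∸ des π
    i<k∸des = proj₁ (proj₂ (proj₂ (proj₂ a∈GS)))

    i-antitone : ∀ {p q} → p Fin.≤ q → i q ≤ i p
    i-antitone = proj₁ (proj₂ (proj₂ (proj₂ (proj₂ a∈GS))))

    a≡ : a ≡ gs π · tail π (m∸n≤m n k) i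
    a≡ = proj₂ (proj₂ (proj₂ (proj₂ (proj₂ a∈GS))))

    A μ : Fin n → ℕ
    A p = lookup a (π ⟨$⟩ʳ p)
    μ p = lookup (tail π (m∸n≤m n k) i) (π ⟨$⟩ʳ p)

    A≡ : ∀ p → A p ≡ descentsFrom π p + μ p
    A≡ p = trans (cong (λ u → lookup u (π ⟨$⟩ʳ p)) a≡)
      (trans (lookup-· (gs π) _ (π ⟨$⟩ʳ p)) (cong (_+ μ p) (lookup-gs π p)))

    μ-antitone : ∀ {p q} → p Fin.≤ q → μ q ≤ μ p
    μ-antitone {p} {q} p≤q with head? (m∸n≤m n k) q
    ... | inj₂ n∸k≤q = ≤-trans (≤-reflexive (lookup-tail-zero π (m∸n≤m n k) i q n∸k≤q)) z≤n
    ... | inj₁ (q′ , refl) with head? (m∸n≤m n k) p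
    ...   | inj₂ n∸k≤p     = contradiction (≤-trans n∸k≤p (≤-trans p≤q (≤-reflexive (Finₚ.toℕ-inject≤ q′ (m∸n≤m n k)))))
                                           (<⇒≱ (Finₚ.toℕ<n q′))
    ...   | inj₁ (p′ , refl) = subst₂ _≤_ (sym (lookup-tail-head π (m∸n≤m n k) i q′))
      (sym (lookup-tail-head π (m∸n≤m n k) i p′))
      (i-antitone (subst₂ _≤_ (Finₚ.toℕ-inject≤ p′ (m∸n≤m n k)) (Finₚ.toℕ-inject≤ q′ (m∸n≤m n k)) p≤q))

    μ<k∸des : ∀ p → μ p < k ∸ des π
    μ<k∸des p with head? (m∸n≤m n k) p
    ... | inj₂ n∸k≤p     = ≤-<-trans (≤-reflexive (lookup-tail-zero π (m∸n≤m n k) i p n∸k≤p)) (m<n⇒0<n∸m des<k)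
    ... | inj₁ (q , refl) = ≤-<-trans (≤-reflexive (lookup-tail-head π (m∸n≤m n k) i q)) (i<k∸des q)

    -- The exponents of `gs π` fall by exactly `drop` and those of the tail are antitone. By
    -- `exponent⇒weight-<` this says that π sorts the letters of `a`.
    step : ∀ p q → toℕ q ≡ suc (toℕ p) → A q + drop π p ≤ A p
    step p q e = begin
      A q + drop π p                            ≡⟨ cong (_+ drop π p) (A≡ q) ⟩
      descentsFrom π q + μ q + drop π p         ≡⟨ +-comm (descentsFrom π q + μ q) (drop π p) ⟩
      drop π p + (descentsFrom π q + μ q)       ≡⟨ +-assoc (drop π p) (descentsFrom π q) (μ q) ⟨
      drop π p + descentsFrom π q + μ q         ≡⟨ cong (_+ μ q) (descentsFrom-step π p q e) ⟨
      descentsFrom π p + μ q                    ≤⟨ +-monoʳ-≤ (descentsFrom π p) (μ-antitone (≤-trans (n≤1+n _) (≤-reflexive (sym e)))) ⟩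
      descentsFrom π p + μ p                    ≡⟨ A≡ p ⟨
      A p                                       ∎
      where open ≤-Reasoning

    sorted : Sorted a π
    sorted {p} {q} p<q with successor? p
    ... | inj₂ last    = contradiction p<q (last q)
    ... | inj₁ (r , e) = ≤-<-trans
      (antitone-from-steps (λ s → weight a (π ⟨$⟩ʳ s))
        (λ s t e → <⇒≤ (exponent⇒weight-< π a s t e (step s t e))) r q (≤-trans (≤-reflexive e) p<q))
      (exponent⇒weight-< π a p r e (step p r e))

    -- From n - k on the tail vanishes, so the exponents fall by exactly `drop` and end with 0; a
    -- gap needs a larger fall or a positive last exponent.
    no-gap : ∀ p → n ∸ k ≤ toℕ p → ¬ Gap a π p
    no-gap p n∸k≤p (n≤Wp , below) with successor? p
    ... | inj₂ last = <⇒≱ (opposite<n (π ⟨$⟩ʳ p)) (≤-trans n≤Wp (≤-reflexive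
      (cong (λ b → b * n + toℕ (Fin.opposite (π ⟨$⟩ʳ p))) (trans (A≡ p) (cong₂ _+_ (descentsFrom-last π p last)
        (lookup-tail-zero π (m∸n≤m n k) i p n∸k≤p))))))
    ... | inj₁ (q , e) = <⇒≱ (below q (≤-reflexive (sym e))) (exponent⇒weight-≤ π a p q e (≤-reflexive (begin
      A p                            ≡⟨ A≡ p ⟩
      descentsFrom π p + μ p         ≡⟨ cong (descentsFrom π p +_) (lookup-tail-zero π (m∸n≤m n k) i p n∸k≤p) ⟩
      descentsFrom π p + 0           ≡⟨ +-identityʳ _ ⟩
      descentsFrom π p               ≡⟨ descentsFrom-step π p q e ⟩
      drop π p + descentsFrom π q    ≡⟨ +-comm (drop π p) _ ⟩
      descentsFrom π q + drop π p    ≡⟨ cong (_+ drop π p) (+-identityʳ _) ⟨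
      descentsFrom π q + 0 + drop π p ≡⟨ cong (λ m → descentsFrom π q + m + drop π p) (lookup-tail-zero π (m∸n≤m n k) i q
                                          (≤-trans n∸k≤p (≤-trans (n≤1+n _) (≤-reflexive (sym e))))) ⟨
      descentsFrom π q + μ q + drop π p ≡⟨ cong (_+ drop π p) (A≡ q) ⟨
      A q + drop π p                 ∎)))
      where open ≡-Reasoning

  GS⇒¬ElementaryLead : ¬ ElementaryLead n k a
  GS⇒¬ElementaryLead lead with p , n∸k≤p , gap ← ElementaryLead⇒Gap a π sorted k lead = no-gap p n∸k≤p gap

  -- Each exponent is at most `des π` from `gs π`, plus less than `k ∸ des π` from the tail.
  GS⇒¬PowerDivides : ¬ PowerDivides n k a
  GS⇒¬PowerDivides (l , k≤al) = <⇒≱ (begin-strict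
    lookup a l                     ≡⟨ cong (lookup a) (inverseʳ π) ⟨
    A p                            ≡⟨ A≡ p ⟩
    descentsFrom π p + μ p         <⟨ +-mono-≤-< (descentsFrom≤des π p) (μ<k∸des p) ⟩
    des π + (k ∸ des π)            ≡⟨ m+[n∸m]≡n (<⇒≤ des<k) ⟩
    k                              ∎) k≤al
    where
    open ≤-Reasoning
    p = π ⟨$⟩ˡ l

module _ {n k : ℕ} (1≤k : 1 ≤ k) (k≤n : k ≤ n) (a : Monomial n) (π : Permutation′ n) (sorted : Sorted a π)
         (¬lead : ¬ ElementaryLead n k a) (¬power : ¬ PowerDivides n k a) where

  private
    A : Fin n → ℕ
    A p = lookup a (π ⟨$⟩ʳ p)

    D : Fin n → ℕ
    D = descentsFrom π

    no-gap : ∀ p → n ∸ k ≤ toℕ p → ¬ Gap a π p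
    no-gap p n∸k≤p gap = ¬lead (Gap⇒ElementaryLead a π sorted k p n∸k≤p gap)

    step : ∀ p q → toℕ q ≡ suc (toℕ p) → A q + drop π p ≤ A p
    step p q e = weight-<⇒exponent π a p q e (sorted (≤-reflexive (sym e)))

    tight-step : ∀ p q → toℕ q ≡ suc (toℕ p) → n ∸ k ≤ toℕ p → A p ≤ A q + drop π p
    tight-step p q e n∸k≤p = weight-≤⇒exponent π a p q e (≮⇒≥ λ w → no-gap p n∸k≤p
      ( ≤-trans (m≤n+m n _) (<⇒≤ w)
      , λ r p<r → ≤-<-trans (+-monoˡ-≤ n (Sorted-≤ a {π} sorted (≤-trans (≤-reflexive e) p<r))) w))

    -- Without gaps the exponents obey the recursion of `descentsFrom` from position n - k on, with
    -- the same value 0 at the last position.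
    tight : ∀ p → Acc Fin._>_ p → n ∸ k ≤ toℕ p → A p ≡ D p
    tight p (acc rec) n∸k≤p with successor? p
    ... | inj₁ (q , e) = begin
      A p               ≡⟨ ≤-antisym (tight-step p q e n∸k≤p) (step p q e) ⟩
      A q + drop π p    ≡⟨ cong (_+ drop π p) (tight q (rec (≤-reflexive (sym e)))
                             (≤-trans n∸k≤p (≤-trans (n≤1+n _) (≤-reflexive (sym e))))) ⟩
      D q + drop π p    ≡⟨ +-comm (D q) (drop π p) ⟩
      drop π p + D q    ≡⟨ descentsFrom-step π p q e ⟨
      D p               ∎
      where open ≡-Reasoning
    ... | inj₂ last = trans (n≤0⇒n≡0 (quotient-≤ (A p) 0 light ≤-refl)) (sym (descentsFrom-last π p last))
      where
      light : weight a (π ⟨$⟩ʳ p) < n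
      light = ≰⇒> λ n≤Wp → no-gap p n∸k≤p (n≤Wp , λ q p<q → contradiction p<q (last q))

    D≤A : ∀ p → Acc Fin._>_ p → D p ≤ A p
    D≤A p (acc rec) with successor? p
    ... | inj₂ last    = ≤-trans (≤-reflexive (descentsFrom-last π p last)) z≤n
    ... | inj₁ (q , e) = begin
      D p               ≡⟨ descentsFrom-step π p q e ⟩
      drop π p + D q    ≤⟨ +-monoʳ-≤ (drop π p) (D≤A q (rec (≤-reflexive (sym e)))) ⟩
      drop π p + A q    ≡⟨ +-comm (drop π p) (A q) ⟩
      A q + drop π p    ≤⟨ step p q e ⟩
      A p               ∎
      where open ≤-Reasoning

    -- What remains after division by `gs π`. It is the chain of exponents i₁ ≥ i₂ ≥ ⋯ and vanishes
    -- from n - k on by `tight`.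
    excess : Fin n → ℕ
    excess p = A p ∸ D p

    excess-antitone : ∀ p q → p Fin.≤ q → excess q ≤ excess p
    excess-antitone = antitone-from-steps excess λ p q e → begin
      A q ∸ D q                            ≡⟨ [m+n]∸[m+o]≡n∸o (drop π p) (A q) (D q) ⟨
      (drop π p + A q) ∸ (drop π p + D q)  ≡⟨ cong₂ _∸_ (+-comm (A q) (drop π p)) (descentsFrom-step π p q e) ⟨
      (A q + drop π p) ∸ D p               ≤⟨ ∸-monoˡ-≤ (D p) (step p q e) ⟩
      A p ∸ D p                            ∎
      where open ≤-Reasoning

    first : Fin n
    first = Fin.fromℕ< (≤-trans 1≤k k≤n)

    first≤ : ∀ (p : Fin n) → first Fin.≤ p
    first≤ p = ≤-trans (≤-reflexive (Finₚ.toℕ-fromℕ< (≤-trans 1≤k k≤n))) z≤n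

    A<k : ∀ p → A p < k
    A<k p = ≰⇒> λ k≤Ap → ¬power (π ⟨$⟩ʳ p , k≤Ap)

    D-first : D first ≡ des π
    D-first = descentsFrom-first π first first≤

    i : Fin (n ∸ k) → ℕ
    i q = excess (inject≤ q (m∸n≤m n k))

    i<k∸des : ∀ q → i q < k ∸ des π
    -- The excess is largest at the first letter, where the exponent is below `k` and `gs π`
    -- accounts for all descents.
    i<k∸des q = ≤-<-trans (excess-antitone first _ (first≤ _)) (subst (λ d → A first ∸ d < k ∸ des π) (sym D-first)
      (∸-monoˡ-< (A<k first) (subst (_≤ A first) D-first (D≤A first (>-wellFounded first)))))

    i-antitone : ∀ {p q} → p Fin.≤ q → i q ≤ i p
    i-antitone {p} {q} p≤q = excess-antitone _ _
      (subst₂ _≤_ (sym (Finₚ.toℕ-inject≤ p (m∸n≤m n k))) (sym (Finₚ.toℕ-inject≤ q (m∸n≤m n k))) p≤q)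

    excess≡tail : ∀ p → excess p ≡ lookup (tail π (m∸n≤m n k) i) (π ⟨$⟩ʳ p)
    excess≡tail p with head? (m∸n≤m n k) p
    ... | inj₁ (q , refl)  = sym (lookup-tail-head π (m∸n≤m n k) i q)
    ... | inj₂ n∸k≤p       = trans (trans (cong (_∸ D p) (tight p (>-wellFounded p) n∸k≤p)) (n∸n≡0 (D p)))
                                   (sym (lookup-tail-zero π (m∸n≤m n k) i p n∸k≤p))

    a≡ : a ≡ gs π · tail π (m∸n≤m n k) i
    a≡ = lookup-extensional λ l → subst (λ m → lookup a m ≡ lookup (gs π · tail π (m∸n≤m n k) i) m)
      (inverseʳ π) (at (π ⟨$⟩ˡ l))
      where
      open ≡-Reasoning
      at : ∀ p → A p ≡ lookup (gs π · tail π (m∸n≤m n k) i) (π ⟨$⟩ʳ p)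
      at p = begin
        A p                                             ≡⟨ m+[n∸m]≡n (D≤A p (>-wellFounded p)) ⟨
        D p + excess p                                  ≡⟨ cong₂ _+_ (sym (lookup-gs π p)) (excess≡tail p) ⟩
        lookup (gs π) (π ⟨$⟩ʳ p) + lookup (tail π (m∸n≤m n k) i) (π ⟨$⟩ʳ p)
          ≡⟨ lookup-· (gs π) (tail π (m∸n≤m n k) i) (π ⟨$⟩ʳ p) ⟨
        lookup (gs π · tail π (m∸n≤m n k) i) (π ⟨$⟩ʳ p) ∎

  sorted⇒GS : GS n k a
  sorted⇒GS = π
    , ≤-<-trans (subst (_≤ A first) D-first (D≤A first (>-wellFounded first))) (A<k first)
    , i , i<k∸des , i-antitone , a≡

-- Multiples of elementary symmetric polynomials

Σℚ : (X → ℚ) → List X → ℚ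
Σℚ f = foldr (λ s r → f s ℚ.+ r) 0ℚ

Σℚ-cong : ∀ {f g : X → ℚ} → (∀ s → f s ≡ g s) → ∀ L → Σℚ f L ≡ Σℚ g L
Σℚ-cong f≗g []      = refl
Σℚ-cong f≗g (s ∷ L) = cong₂ ℚ._+_ (f≗g s) (Σℚ-cong f≗g L)

Σℚ-++ : ∀ (f : X → ℚ) L M → Σℚ f (L ++ M) ≡ Σℚ f L ℚ.+ Σℚ f M
Σℚ-++ f []      M = sym (ℚₚ.+-identityˡ _)
Σℚ-++ f (s ∷ L) M = trans (cong (f s ℚ.+_) (Σℚ-++ f L M)) (sym (ℚₚ.+-assoc (f s) _ _))

Σℚ-map : ∀ (f : X → ℚ) (h : Y → X) L → Σℚ f (List.map h L) ≡ Σℚ (f ∘ h) L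
Σℚ-map f h []      = refl
Σℚ-map f h (s ∷ L) = cong (f (h s) ℚ.+_) (Σℚ-map f h L)

Σℚ-filter : ∀ {P : Pred X 0ℓ} (P? : Decidable P) (f : X → ℚ) L →
            Σℚ f (filter P? L) ≡ Σℚ (λ s → if does (P? s) then f s else 0ℚ) L
Σℚ-filter P? f []      = refl
Σℚ-filter P? f (s ∷ L) with does (P? s)
... | true  = cong (f s ℚ.+_) (Σℚ-filter P? f L)
... | false = trans (Σℚ-filter P? f L) (sym (ℚₚ.+-identityˡ _))

Σℚ-zero : ∀ (L : List X) → Σℚ (λ _ → 0ℚ) L ≡ 0ℚ
Σℚ-zero []      = refl
Σℚ-zero (s ∷ L) = trans (ℚₚ.+-identityˡ _) (Σℚ-zero L)

Σℚ-distrib-+ : ∀ (f g : X → ℚ) L → Σℚ (λ s → f s ℚ.+ g s) L ≡ Σℚ f L ℚ.+ Σℚ g L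
Σℚ-distrib-+ f g []      = refl
Σℚ-distrib-+ f g (s ∷ L) = trans (cong (f s ℚ.+ g s ℚ.+_) (Σℚ-distrib-+ f g L))
  (solve 4 (λ a b c d → (a :+ b) :+ (c :+ d) := (a :+ c) :+ (b :+ d)) refl
         (f s) (g s) (Σℚ f L) (Σℚ g L))
  where open +-*-Solver

Σℚ-comm : ∀ (f : X → Y → ℚ) L M →
          Σℚ (λ s → Σℚ (f s) M) L ≡ Σℚ (λ t → Σℚ (λ s → f s t) L) M
Σℚ-comm f []      M = sym (Σℚ-zero M)
Σℚ-comm f (s ∷ L) M = trans (cong (Σℚ (f s) M ℚ.+_) (Σℚ-comm f L M))
  (sym (Σℚ-distrib-+ (f s) (λ t → Σℚ (λ r → f r t) L) M))

closed-∸ : ∀ {V : Pred (Polynomial n) 0ℓ} → IsSubspace V → ∀ f h → f +ₚ h ∈ V → h ∈ V → f ∈ V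
closed-∸ V-sub f h f+h∈V h∈V = closed-≋ {f = (f +ₚ h) +ₚ -ₚ h} {f}
  (λ g → trans (eval-+ g (f +ₚ h) (-ₚ h)) (trans (cong₂ ℚ._+_ (eval-+ g f h) (eval-• g (ℚ.- 1ℚ) h))
    (solve 2 (λ a b → (a :+ b) :+ con (ℚ.- 1ℚ) :* b := a) refl (eval g f) (eval g h))))
  (closed-+ f+h∈V (closed-• (ℚ.- 1ℚ) h∈V))
  where
  open IsSubspace V-sub
  open +-*-Solver

-- With `ofSize n j` this is x^b e_j. Other lists of subsets give the partial sums of x^b e_j that
-- remain when some terms are set aside.
terms : Monomial n → List (Subset n) → Polynomial n
terms b = List.map (λ s → 1ℚ , b · squarefree s)

ofSize : ∀ n → ℕ → List (Subset n)
ofSize n j = filter (λ s → ∣ s ∣ ℕₚ.≟ j) (subsets n)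

eval-terms : ∀ g b (L : List (Subset n)) → eval g (terms b L) ≡ Σℚ (λ s → g (b · squarefree s)) L
eval-terms g b []      = refl
eval-terms g b (s ∷ L) = cong₂ ℚ._+_ (ℚₚ.*-identityˡ (g (b · squarefree s))) (eval-terms g b L)

monomial-*-elementary : ∀ (b : Monomial n) j → monomial b *ₚ elementary n j ≋ terms b (ofSize n j)
monomial-*-elementary {n} b j g =
  trans (eval-shift g b (elementary n j)) (go (ofSize n j))
  where
  go : ∀ L → eval (λ v → g (b · v)) (List.map (λ s → 1ℚ , squarefree s) L) ≡ eval g (terms b L)
  go []      = refl
  go (s ∷ L) = cong (1ℚ ℚ.* g (b · squarefree s) ℚ.+_) (go L)

subsets-complete : (s : Subset n) → s ∈ˡ subsets n
subsets-complete         []          = here refl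
subsets-complete {suc n} (false ∷ s) = ∈ₚ.∈-++⁺ˡ (∈ₚ.∈-map⁺ (false ∷_) (subsets-complete s))
subsets-complete {suc n} (true ∷ s)  =
  ∈ₚ.∈-++⁺ʳ (List.map (false ∷_) (subsets n)) (∈ₚ.∈-map⁺ (true ∷_) (subsets-complete s))

subsets-unique : ∀ n → Unique (subsets n)
subsets-unique zero    = [] ∷ []
subsets-unique (suc n) = Uniqueₚ.++⁺ (Uniqueₚ.map⁺ Vecₚ.∷-injectiveʳ (subsets-unique n))
  (Uniqueₚ.map⁺ Vecₚ.∷-injectiveʳ (subsets-unique n)) disjoint
  where
  disjoint : ∀ {s} → ¬ (s ∈ˡ List.map (false ∷_) (subsets n) × s ∈ˡ List.map (true ∷_) (subsets n))
  disjoint (p , q) with _ , _ , refl ← ∈ₚ.∈-map⁻ (false ∷_) p with _ , _ , () ← ∈ₚ.∈-map⁻ (true ∷_) q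

_≟ˢ_ : (S T : Subset n) → Dec (S ≡ T)
_≟ˢ_ = Vecₚ.≡-dec Boolₚ._≟_

others : Subset n → List (Subset n)
others {n} T = filter (λ s → ¬? (s ≟ˢ T)) (ofSize n ∣ T ∣)

others-all : (T : Subset n) → All (λ s → ∣ s ∣ ≡ ∣ T ∣ × s ≢ T) (others T)
others-all {n} T = All.zip
  ( Allₚ.filter⁺ (λ s → ¬? (s ≟ˢ T)) (Allₚ.all-filter (λ s → ∣ s ∣ ℕₚ.≟ ∣ T ∣) (subsets n))
  , Allₚ.all-filter (λ s → ¬? (s ≟ˢ T)) (ofSize n ∣ T ∣))

Σℚ-extract : ∀ f (T : Subset n) → Σℚ f (ofSize n ∣ T ∣) ≡ f T ℚ.+ Σℚ f (others T)
Σℚ-extract {n} f T = go (ofSize n ∣ T ∣)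
  (Uniqueₚ.filter⁺ (λ s → ∣ s ∣ ℕₚ.≟ ∣ T ∣) (subsets-unique n))
  (∈ₚ.∈-filter⁺ (λ s → ∣ s ∣ ℕₚ.≟ ∣ T ∣) (subsets-complete T) refl)
  where
  open +-*-Solver
  ≢T? = λ s → ¬? (s ≟ˢ T)
  go : ∀ L → Unique L → T ∈ˡ L → Σℚ f L ≡ f T ℚ.+ Σℚ f (filter ≢T? L)
  go (s ∷ L) (s∉L ∷ unique) (here refl) = cong (f s ℚ.+_) (cong (Σℚ f) (sym (trans
    (Listₚ.filter-reject ≢T? {xs = L} (λ ne → ne refl))
    (Listₚ.filter-all ≢T? (All.map (λ ne e → ne (sym e)) s∉L)))))
  go (s ∷ L) (s∉L ∷ unique) (there T∈L) = begin
    f s ℚ.+ Σℚ f L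
      ≡⟨ cong (f s ℚ.+_) (go L unique T∈L) ⟩
    f s ℚ.+ (f T ℚ.+ Σℚ f (filter ≢T? L))
      ≡⟨ solve 3 (λ a b c → a :+ (b :+ c) := b :+ (a :+ c)) refl (f s) (f T) (Σℚ f (filter ≢T? L)) ⟩
    f T ℚ.+ (f s ℚ.+ Σℚ f (filter ≢T? L))
      ≡⟨ cong (λ M → f T ℚ.+ Σℚ f M) (Listₚ.filter-accept ≢T? {xs = L} (All.lookup s∉L T∈L)) ⟨
    f T ℚ.+ Σℚ f (filter ≢T? (s ∷ L)) ∎
    where open ≡-Reasoning

terms-extract : ∀ b (T : Subset n) →
                terms b (ofSize n ∣ T ∣) ≋ monomial (b · squarefree T) +ₚ terms b (others T)
terms-extract {n} b T g = trans (eval-terms g b (ofSize n ∣ T ∣))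
  (trans (Σℚ-extract (λ s → g (b · squarefree s)) T)
         (cong₂ ℚ._+_ (sym (ℚₚ.*-identityˡ (g (b · squarefree T)))) (sym (eval-terms g b (others T)))))

rank-maximal : ∀ {b} {S T : Subset n} → Top b T → ∣ S ∣ ≡ ∣ T ∣ → S ≢ T →
               rank (b · squarefree S) < rank (b · squarefree T)
rank-maximal {b = b} {S} {T} top e S≢T with Top-maximal {S = S} top e
... | inj₁ S≡T = contradiction S≡T S≢T
... | inj₂ lt  = subst₂ _<_ (sym (rank-·-squarefree b S)) (sym (rank-·-squarefree b T))
                            (+-monoʳ-< (rank b) lt)

terms-leads : ∀ {b} {T : Subset n} → Top b T → Leads rank (b · squarefree T) (terms b (ofSize n ∣ T ∣))
terms-leads {n} {b} {T} top = terms b (others T) , terms-extract b T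
  , Allₚ.map⁺ (All.map (λ (e , ne) → rank-maximal top e ne) (others-all T))

-- The expansion of x^c times two sums of squarefree monomials. Expanding the first sum leaves
-- multiples of the second, which are again of the form `terms`.
double : Monomial n → List (Subset n) → List (Subset n) → Polynomial n
double c L M = bind (λ u → terms u M) (terms c L)

eval-double : ∀ g c (L M : List (Subset n)) → eval g (double c L M) ≡
              Σℚ (λ s → Σℚ (λ t → g ((c · squarefree s) · squarefree t)) M) L
eval-double g c L M = trans (eval-bind g (λ u → terms u M) (terms c L))
  (trans (eval-terms _ c L) (Σℚ-cong (λ s → eval-terms g (c · squarefree s) M) L))

·-swap : (u v w : Monomial n) → (u · v) · w ≡ (u · w) · v
·-swap u v w = trans (·-assoc u v w) (trans (cong (u ·_) (·-comm v w)) (sym (·-assoc u w v)))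

double-comm : ∀ c (L M : List (Subset n)) → double c L M ≋ double c M L
double-comm c L M g = begin
  eval g (double c L M)
    ≡⟨ eval-double g c L M ⟩
  Σℚ (λ s → Σℚ (λ t → g ((c · squarefree s) · squarefree t)) M) L
    ≡⟨ Σℚ-comm (λ s t → g ((c · squarefree s) · squarefree t)) L M ⟩
  Σℚ (λ t → Σℚ (λ s → g ((c · squarefree s) · squarefree t)) L) M
    ≡⟨ Σℚ-cong (λ t → Σℚ-cong (λ s → cong g (·-swap c (squarefree s) (squarefree t))) L) M ⟩
  Σℚ (λ t → Σℚ (λ s → g ((c · squarefree t) · squarefree s)) L) M
    ≡⟨ eval-double g c M L ⟨
  eval g (double c M L) ∎
  where open ≡-Reasoning

double-extract : ∀ c (T : Subset n) M →
  double c (ofSize n ∣ T ∣) M ≋ terms (c · squarefree T) M +ₚ double c (others T) M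
double-extract {n} c T M g = begin
  eval g (double c (ofSize n ∣ T ∣) M)
    ≡⟨ eval-double g c (ofSize n ∣ T ∣) M ⟩
  Σℚ φ (ofSize n ∣ T ∣)
    ≡⟨ Σℚ-extract φ T ⟩
  φ T ℚ.+ Σℚ φ (others T)
    ≡⟨ cong₂ ℚ._+_ (eval-terms g (c · squarefree T) M) (eval-double g c (others T) M) ⟨
  eval g (terms (c · squarefree T) M) ℚ.+ eval g (double c (others T) M)
    ≡⟨ eval-+ g (terms (c · squarefree T) M) (double c (others T) M) ⟨
  eval g (terms (c · squarefree T) M +ₚ double c (others T) M) ∎
  where
  open ≡-Reasoning
  φ = λ s → Σℚ (λ t → g ((c · squarefree s) · squarefree t)) M

-- Elementary symmetric polynomials with one letter omitted.

has : Fin n → Bool → ℕ → List (Subset n)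
has {n} i e j = filter (λ s → (∣ s ∣ ℕₚ.≟ j) ×-dec (lookup s i Boolₚ.≟ e)) (subsets n)

has-all : ∀ (i : Fin n) e j → All (λ s → ∣ s ∣ ≡ j × lookup s i ≡ e) (has i e j)
has-all {n} i e j = Allₚ.all-filter (λ s → (∣ s ∣ ℕₚ.≟ j) ×-dec (lookup s i Boolₚ.≟ e)) (subsets n)

terms-split : ∀ b (i : Fin n) j → terms b (ofSize n j) ≋ terms b (has i true j) +ₚ terms b (has i false j)
terms-split {n} b i j g = begin
  eval g (terms b (ofSize n j))
    ≡⟨ trans (eval-terms g b (ofSize n j)) (Σℚ-filter (λ s → ∣ s ∣ ℕₚ.≟ j) φ (subsets n)) ⟩
  Σℚ (λ s → if does (∣ s ∣ ℕₚ.≟ j) then φ s else 0ℚ) (subsets n)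
    ≡⟨ Σℚ-cong (λ s → split (does (∣ s ∣ ℕₚ.≟ j)) (lookup s i) (φ s)) (subsets n) ⟩
  Σℚ (λ s → part true s ℚ.+ part false s) (subsets n)
    ≡⟨ Σℚ-distrib-+ (part true) (part false) (subsets n) ⟩
  Σℚ (part true) (subsets n) ℚ.+ Σℚ (part false) (subsets n)
    ≡⟨ cong₂ ℚ._+_ (whole true) (whole false) ⟨
  eval g (terms b (has i true j)) ℚ.+ eval g (terms b (has i false j))
    ≡⟨ eval-+ g (terms b (has i true j)) (terms b (has i false j)) ⟨
  eval g (terms b (has i true j) +ₚ terms b (has i false j)) ∎
  where
  open ≡-Reasoning
  φ : Subset n → ℚ
  φ s = g (b · squarefree s)

  part : Bool → Subset n → ℚ
  part e s = if does (∣ s ∣ ℕₚ.≟ j) ∧ does (lookup s i Boolₚ.≟ e) then φ s else 0ℚ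

  whole : ∀ e → eval g (terms b (has i e j)) ≡ Σℚ (part e) (subsets n)
  whole e = trans (eval-terms g b (has i e j))
    (Σℚ-filter (λ s → (∣ s ∣ ℕₚ.≟ j) ×-dec (lookup s i Boolₚ.≟ e)) φ (subsets n))

  split : ∀ c d q → (if c then q else 0ℚ) ≡
          (if c ∧ does (d Boolₚ.≟ true) then q else 0ℚ) ℚ.+ (if c ∧ does (d Boolₚ.≟ false) then q else 0ℚ)
  split false d     q = refl
  split true  true  q = sym (ℚₚ.+-identityʳ q)
  split true  false q = sym (ℚₚ.+-identityˡ q)

Σℚ-subsets : ∀ (f : Subset (suc n) → ℚ) →
  Σℚ f (subsets (suc n)) ≡ Σℚ (f ∘ (false ∷_)) (subsets n) ℚ.+ Σℚ (f ∘ (true ∷_)) (subsets n)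
Σℚ-subsets {n} f = trans (Σℚ-++ f (List.map (false ∷_) (subsets n)) (List.map (true ∷_) (subsets n)))
  (cong₂ ℚ._+_ (Σℚ-map f (false ∷_) (subsets n)) (Σℚ-map f (true ∷_) (subsets n)))

module _ (i : Fin n) (χ : ℕ → Bool) (g : Monomial n → ℚ) where

  omitting containing : Subset n → ℚ
  omitting   s = if χ (suc ∣ s ∣) ∧ does (lookup s i Boolₚ.≟ false) then g (x i · squarefree s) else 0ℚ
  containing s = if χ ∣ s ∣ ∧ does (lookup s i Boolₚ.≟ true) then g (squarefree s) else 0ℚ

-- The size condition is kept as an arbitrary χ so that the induction can shift it.

Σℚ-insert : ∀ (i : Fin n) χ g → Σℚ (omitting i χ g) (subsets n) ≡ Σℚ (containing i χ g) (subsets n)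
Σℚ-insert {suc n} zero χ g = begin
  Σℚ (omitting zero χ g) (subsets (suc n))
    ≡⟨ Σℚ-subsets (omitting zero χ g) ⟩
  Σℚ (omitting zero χ g ∘ (false ∷_)) (subsets n) ℚ.+ Σℚ (omitting zero χ g ∘ (true ∷_)) (subsets n)
    ≡⟨ cong₂ ℚ._+_
         (Σℚ-cong (λ s → cong₂ (λ c u → if c then g (1 ∷ u) else 0ℚ)
           (Boolₚ.∧-identityʳ (χ (suc ∣ s ∣))) (1ᵐ-identityˡ (squarefree s))) (subsets n))
         (vanish (λ s → χ (suc (suc ∣ s ∣))) (λ s → g (x zero · squarefree (true ∷ s)))) ⟩
  Σℚ φ (subsets n) ℚ.+ 0ℚ
    ≡⟨ ℚₚ.+-comm (Σℚ φ (subsets n)) 0ℚ ⟩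
  0ℚ ℚ.+ Σℚ φ (subsets n)
    ≡⟨ cong₂ ℚ._+_ (vanish (λ s → χ ∣ s ∣) (λ s → g (0 ∷ squarefree s)))
         (Σℚ-cong (λ s → cong (if_then g (1 ∷ squarefree s) else 0ℚ) (Boolₚ.∧-identityʳ (χ (suc ∣ s ∣)))) (subsets n)) ⟨
  Σℚ (containing zero χ g ∘ (false ∷_)) (subsets n) ℚ.+ Σℚ (containing zero χ g ∘ (true ∷_)) (subsets n)
    ≡⟨ Σℚ-subsets (containing zero χ g) ⟨
  Σℚ (containing zero χ g) (subsets (suc n)) ∎
  where
  open ≡-Reasoning
  φ : Subset n → ℚ
  φ s = if χ (suc ∣ s ∣) then g (1 ∷ squarefree s) else 0ℚ

  vanish : ∀ (c : Subset n → Bool) (h : Subset n → ℚ) →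
           Σℚ (λ s → if c s ∧ false then h s else 0ℚ) (subsets n) ≡ 0ℚ
  vanish c h = trans (Σℚ-cong (λ s → cong (if_then h s else 0ℚ) (Boolₚ.∧-zeroʳ (c s))) (subsets n))
                     (Σℚ-zero (subsets n))
Σℚ-insert {suc n} (suc i) χ g = trans (Σℚ-subsets (omitting (suc i) χ g)) (trans
  (cong₂ ℚ._+_ (Σℚ-insert i χ (λ u → g (0 ∷ u))) (Σℚ-insert i (χ ∘ suc) (λ u → g (1 ∷ u))))
  (sym (Σℚ-subsets (containing (suc i) χ g))))

-- Insertion of `i` is a bijection from the j-subsets without `i` onto the (j + 1)-subsets
-- containing `i`.
terms-insert : ∀ b (i : Fin n) j → terms (b · x i) (has i false j) ≋ terms b (has i true (suc j))
terms-insert {n} b i j g = begin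
  eval g (terms (b · x i) (has i false j))
    ≡⟨ trans (eval-terms g (b · x i) (has i false j))
         (Σℚ-filter (λ s → (∣ s ∣ ℕₚ.≟ j) ×-dec (lookup s i Boolₚ.≟ false)) _ (subsets n)) ⟩
  Σℚ (λ s → if does (∣ s ∣ ℕₚ.≟ j) ∧ does (lookup s i Boolₚ.≟ false) then g ((b · x i) · squarefree s) else 0ℚ) (subsets n)
    ≡⟨ Σℚ-cong (λ s → cong (λ u → if does (∣ s ∣ ℕₚ.≟ j) ∧ does (lookup s i Boolₚ.≟ false) then g u else 0ℚ)
         (·-assoc b (x i) (squarefree s))) (subsets n) ⟩
  -- The size condition is m = j + 1; at m = suc ∣ s ∣ it computes to the condition ∣ s ∣ = j on the
  -- left-hand side.
  _ ≡⟨ Σℚ-insert i (λ m → does (m ℕₚ.≟ suc j)) (λ u → g (b · u)) ⟩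
  _ ≡⟨ trans (eval-terms g b (has i true (suc j)))
         (Σℚ-filter (λ s → (∣ s ∣ ℕₚ.≟ suc j) ×-dec (lookup s i Boolₚ.≟ true)) _ (subsets n)) ⟨
  eval g (terms b (has i true (suc j))) ∎
  where open ≡-Reasoning

-- Triangular spanning families of the ideals

factor-power : ∀ (b : Monomial n) i r → r ≤ lookup b i → ∃ λ c → b ≡ c · (x i ^ r) × lookup b i ≡ lookup c i + r
factor-power {n} b i r r≤ = c , lookup-extensional b≡ , sym (trans (cong (_+ r) c-at) (m∸n+n≡m r≤))
  where
  c : Monomial n
  c = b Vec.[ i ]≔ (lookup b i ∸ r)

  c-at : lookup c i ≡ lookup b i ∸ r
  c-at = Vecₚ.lookup∘update i b (lookup b i ∸ r)

  b≡ : ∀ l → lookup b l ≡ lookup (c · (x i ^ r)) l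
  b≡ l rewrite lookup-· c (x i ^ r) l | Vecₚ.lookup-map l (r *_) (x i) with l Finₚ.≟ i
  ... | yes refl rewrite lookup-x-≡ l | c-at | *-identityʳ r = sym (m∸n+n≡m r≤)
  ... | no  l≢i  rewrite lookup-x-≢ l≢i | *-zeroʳ r | Vecₚ.lookup∘update′ l≢i b (lookup b i ∸ r) = sym (+-identityʳ _)

lookup-power : ∀ (b : Monomial n) i r → r ≤ lookup (b · (x i ^ r)) i
lookup-power b i r rewrite lookup-· b (x i ^ r) i | Vecₚ.lookup-map i (r *_) (x i) | lookup-x-≡ i | *-identityʳ r =
  m≤n+m r (lookup b i)

^1-identity : (u : Monomial n) → u ^ 1 ≡ u
^1-identity u = trans (Vecₚ.map-cong *-identityˡ u) (Vecₚ.map-id u)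

∣∣<n : ∀ (s : Subset n) i → lookup s i ≡ false → ∣ s ∣ < n
∣∣<n {n} s i e = ≤∧≢⇒< (Subsetₚ.∣p∣≤n s) λ full →
  contradiction (trans (sym e) (trans (cong (λ t → lookup t i) (Subsetₚ.∣p∣≡n⇒p≡⊤ {p = s} full)) (Vecₚ.lookup-replicate i true))) λ ()

module _ (n k : ℕ) where

  elementaryLead : Decidable (ElementaryLead n k)
  elementaryLead a = elementaryLead? a (proj₁ (sort a)) (proj₂ (sort a)) k

  private
    -- Away from the leading monomials of E the family consists of monomials, so that it is
    -- triangular on all indices, as `Span-lower` and `triangular` demand. The decision is an
    -- argument in order that proofs can split on it.
    E-basis′ : ∀ a → Dec (ElementaryLead n k a) → Polynomial n
    E-basis′ a (yes (b , T , _)) = terms b (ofSize n ∣ T ∣)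
    E-basis′ a (no  _)           = monomial a

  E-basis : Monomial n → Polynomial n
  E-basis a = E-basis′ a (elementaryLead a)

  E-basis-lead : ∀ {a} → ElementaryLead n k a → ∃₂ λ b T → Top b T × n ∸ k < ∣ T ∣ ×
                 a ≡ b · squarefree T × E-basis a ≡ terms b (ofSize n ∣ T ∣)
  E-basis-lead {a} lead = go (elementaryLead a)
    where
    go : (d : Dec (ElementaryLead n k a)) → ∃₂ λ b T → Top b T × n ∸ k < ∣ T ∣ ×
         a ≡ b · squarefree T × E-basis′ a d ≡ terms b (ofSize n ∣ T ∣)
    go (yes (b , T , top , size , a≡)) = b , T , top , size , a≡ , refl
    go (no ¬lead)                      = contradiction lead ¬lead

  E-basis-leads : ∀ a → Leads rank a (E-basis a)
  E-basis-leads a = go (elementaryLead a)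
    where
    go : (d : Dec (ElementaryLead n k a)) → Leads rank a (E-basis′ a d)
    go (yes (b , T , top , _ , refl)) = terms-leads top
    go (no  _)                        = monomial-leads rank a

  E-basis-¬lead : ∀ {a} → ¬ ElementaryLead n k a → E-basis a ≡ monomial a
  E-basis-¬lead {a} ¬lead = go (elementaryLead a)
    where
    go : (d : Dec (ElementaryLead n k a)) → E-basis′ a d ≡ monomial a
    go (yes lead) = contradiction lead ¬lead
    go (no _)     = refl

  -- E-span is the ideal ⟨ e_d ∣ n - k < d ≤ n ⟩, and I-span below is I n k.

  E-span : Pred (Polynomial n) 0ℓ
  E-span = Span (ElementaryLead n k) E-basis

  private
    E-sub : IsSubspace E-span
    E-sub = Span-isSubspace

  open IsSubspace E-sub

  -- Both groupings of x^c e_∣T∣ e_∣T′∣ are equal. Each isolates the multiple belonging to one top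
  -- set, so one multiple can be traded for the other modulo the remaining summands.
  exchange : ∀ c (T T′ : Subset n) →
    terms (c · squarefree T) (ofSize n ∣ T′ ∣) ∈ E-span →
    double c (others T) (ofSize n ∣ T′ ∣) ∈ E-span →
    double c (others T′) (ofSize n ∣ T ∣) ∈ E-span →
    terms (c · squarefree T′) (ofSize n ∣ T ∣) ∈ E-span
  exchange c T T′ p q r = closed-∸ E-sub u v (closed-≋ {f = w′} {u +ₚ v} w′≋ (closed-+ {u′} {v′} p q)) r
    where
    u v u′ v′ w′ : Polynomial n
    u  = terms (c · squarefree T′) (ofSize n ∣ T ∣)
    v  = double c (others T′) (ofSize n ∣ T ∣)
    u′ = terms (c · squarefree T) (ofSize n ∣ T′ ∣)
    v′ = double c (others T) (ofSize n ∣ T′ ∣)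
    w′ = u′ +ₚ v′

    w′≋ : w′ ≋ u +ₚ v
    w′≋ g = trans (sym (double-extract c T (ofSize n ∣ T′ ∣) g))
      (trans (double-comm c (ofSize n ∣ T ∣) (ofSize n ∣ T′ ∣) g) (double-extract c T′ (ofSize n ∣ T ∣) g))

  basis∈E-span : ∀ {a} → ElementaryLead n k a → E-basis a ∈ E-span
  basis∈E-span {a} lead = Span-generator {Q = ElementaryLead n k} {F = E-basis} {a = a} lead

  -- Induction on the leading rank. If the family holds a different product with this leading
  -- monomial, `Top-confluence` supplies a common `c`, and `exchange` passes to the product in the
  -- family; the remaining summands lead with smaller rank.
  terms∈E-span-top : ∀ b T → Top b T → n ∸ k < ∣ T ∣ → Acc _<_ (rank (b · squarefree T)) →
                     terms b (ofSize n ∣ T ∣) ∈ E-span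
  terms∈E-span-top b T top size (acc rec) = reduce (E-basis-lead lead)
    where
    lead : ElementaryLead n k (b · squarefree T)
    lead = b , T , top , size , refl

    lower : ∀ {c S S′} → Top c S → Top c S′ → n ∸ k < ∣ S′ ∣ →
            rank ((c · squarefree S) · squarefree S′) ≤ rank (b · squarefree T) →
            double c (others S) (ofSize n ∣ S′ ∣) ∈ E-span
    lower {c} {S} {S′} topS topS′ size bound =
      closed-bind (λ u → terms u (ofSize n ∣ S′ ∣)) {terms c (others S)} (Allₚ.map⁺ (All.map each (others-all S)))
      where
      each : ∀ {s} → ∣ s ∣ ≡ ∣ S ∣ × s ≢ S → terms (c · squarefree s) (ofSize n ∣ S′ ∣) ∈ E-span
      each {s} (e , s≢S) = at-top (Top-exists (c · squarefree s) ∣ S′ ∣ (≤-trans (s≤s z≤n) size) (Subsetₚ.∣p∣≤n S′))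
        where
        at-top : (∃ λ t → Top (c · squarefree s) t × ∣ t ∣ ≡ ∣ S′ ∣) →
                 terms (c · squarefree s) (ofSize n ∣ S′ ∣) ∈ E-span
        at-top (t , top , e′) = subst (λ j → terms (c · squarefree s) (ofSize n j) ∈ E-span) e′
          (terms∈E-span-top (c · squarefree s) t top (subst (n ∸ k <_) (sym e′) size)
            -- `t` need not be on top of `c`: the estimate admits any set of the right size beside a
            -- set `s` different from `S`.
            (rec (<-≤-trans (rank-double-maximal topS′ topS e′ e s≢S) bound)))

    reduce : (∃₂ λ b′ T′ → Top b′ T′ × n ∸ k < ∣ T′ ∣ × b · squarefree T ≡ b′ · squarefree T′ ×
              E-basis (b · squarefree T) ≡ terms b′ (ofSize n ∣ T′ ∣)) →
             terms b (ofSize n ∣ T ∣) ∈ E-span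
    reduce (b′ , T′ , top′ , size′ , a≡ , basis≡) = case T ≟ˢ T′ of λ
      { (yes T≡T′) → subst (_∈ E-span) (trans basis≡ (same T≡T′)) (basis∈E-span lead)
      ; (no  T≢T′) → confluent (Top-confluence top top′ a≡ T≢T′) }
      where
      same : T ≡ T′ → terms b′ (ofSize n ∣ T′ ∣) ≡ terms b (ofSize n ∣ T ∣)
      same refl = cong (λ c → terms c (ofSize n ∣ T ∣)) (·-cancelˡ (squarefree T)
        (trans (·-comm (squarefree T) b′) (trans (sym a≡) (·-comm b (squarefree T)))))

      confluent : (∃ λ c → Top c T × Top c T′ × b ≡ c · squarefree T′ × b′ ≡ c · squarefree T) →
                  terms b (ofSize n ∣ T ∣) ∈ E-span
      confluent (c , topT , topT′ , b≡ , b′≡) =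
        subst (λ d → terms d (ofSize n ∣ T ∣) ∈ E-span) (sym b≡) (exchange c T T′
          (subst (_∈ E-span) (trans basis≡ (cong (λ d → terms d (ofSize n ∣ T′ ∣)) b′≡)) (basis∈E-span lead))
          (lower topT topT′ size′ (≤-reflexive (cong rank
            (trans (cong (_· squarefree T′) (sym b′≡)) (sym a≡)))))
          (lower topT′ topT size (≤-reflexive (cong (λ d → rank (d · squarefree T)) (sym b≡)))))

  -- The empty sums with `j` > `n` are included because the recursion of `omitted∈E-span` can run
  -- past degree `n`.
  terms∈E-span : ∀ b j → n ∸ k < j → terms b (ofSize n j) ∈ E-span
  terms∈E-span b j size = case j ≤? n of λ
    { (yes j≤n) → at-top (Top-exists b j (≤-trans (s≤s z≤n) size) j≤n)
    ; (no  j≰n) → closed-terms (Allₚ.map⁺ (All.map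
        (λ {s} e → contradiction (≤-trans (≤-reflexive (sym e)) (Subsetₚ.∣p∣≤n s)) j≰n)
        (Allₚ.all-filter (λ s → ∣ s ∣ ℕₚ.≟ j) (subsets n)))) }
    where
    at-top : (∃ λ T → Top b T × ∣ T ∣ ≡ j) → terms b (ofSize n j) ∈ E-span
    at-top (T , top , refl) = terms∈E-span-top b T top size (<-wellFounded (rank (b · squarefree T)))

  -- xᵢ e_j(x̂ᵢ) = e_{j+1}(x) - e_{j+1}(x̂ᵢ), and e_n(x̂ᵢ) = 0, where x̂ᵢ omits xᵢ.

  omitted∈E-span : ∀ r b i j → r ≤ lookup b i → n ≤ r + j → n ∸ k < j → terms b (has i false j) ∈ E-span
  omitted∈E-span zero    b i j r≤ n≤j size = closed-terms (Allₚ.map⁺ (All.map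
    (λ {s} (e , s∌i) → contradiction (≤-trans n≤j (≤-reflexive (sym e))) (<⇒≱ (∣∣<n s i s∌i))) (has-all i false j)))
  omitted∈E-span (suc r) b i j r≤ n≤ size = step (factor-power b i 1 (≤-trans (s≤s z≤n) r≤))
    where
    step : (∃ λ c → b ≡ c · (x i ^ 1) × lookup b i ≡ lookup c i + 1) → terms b (has i false j) ∈ E-span
    step (c , b≡ , b-at) =
      subst (λ d → terms d (has i false j) ∈ E-span) (sym (trans b≡ (cong (c ·_) (^1-identity (x i)))))
        (closed-≋ {f = u} {terms (c · x i) (has i false j)} (λ g → sym (terms-insert c i j g))
          (closed-∸ E-sub u v
            (closed-≋ {f = terms c (ofSize n (suc j))} {u +ₚ v} (terms-split c i (suc j))
              (terms∈E-span c (suc j) (m<n⇒m<1+n size)))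
            (omitted∈E-span r c i (suc j) (s≤s⁻¹ (≤-trans r≤ (≤-reflexive (trans b-at (+-comm (lookup c i) 1)))))
              (≤-trans n≤ (≤-reflexive (sym (+-suc r j)))) (m<n⇒m<1+n size))))
      where
      u v : Polynomial n
      u = terms c (has i true (suc j))
      v = terms c (has i false (suc j))

  private
    -- Powers take precedence: a multiple of some xᵢᵏ represents itself even if it is also a leading
    -- monomial of E. The element of `E-basis` displaced in this way has to be recovered by
    -- `E-basis∈I-span`.
    I-basis′ : ∀ a → Dec (PowerDivides n k a) → Polynomial n
    I-basis′ a (yes _) = monomial a
    I-basis′ a (no  _) = E-basis a

  I-basis : Monomial n → Polynomial n
  I-basis a = I-basis′ a (powerDivides? k a)

  I-basis-leads : ∀ a → Leads rank a (I-basis a)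
  I-basis-leads a = go (powerDivides? k a)
    where
    go : (d : Dec (PowerDivides n k a)) → Leads rank a (I-basis′ a d)
    go (yes _) = monomial-leads rank a
    go (no  _) = E-basis-leads a

  I-basis-power : ∀ {a} → PowerDivides n k a → I-basis a ≡ monomial a
  I-basis-power {a} divides = go (powerDivides? k a)
    where
    go : (d : Dec (PowerDivides n k a)) → I-basis′ a d ≡ monomial a
    go (yes _)       = refl
    go (no ¬divides) = contradiction divides ¬divides

  I-basis-¬power : ∀ {a} → ¬ PowerDivides n k a → I-basis a ≡ E-basis a
  I-basis-¬power {a} ¬divides = go (powerDivides? k a)
    where
    go : (d : Dec (PowerDivides n k a)) → I-basis′ a d ≡ E-basis a
    go (yes divides) = contradiction divides ¬divides
    go (no  _)       = refl

  NonStandard : Pred (Monomial n) 0ℓ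
  NonStandard a = ElementaryLead n k a ⊎ PowerDivides n k a

  I-span : Pred (Polynomial n) 0ℓ
  I-span = Span NonStandard I-basis

  private
    module V = IsSubspace (Span-isSubspace {Q = NonStandard} {F = I-basis})

  power∈I-span : ∀ {a} → PowerDivides n k a → monomial a ∈ I-span
  power∈I-span {a} divides = subst (_∈ I-span) (I-basis-power divides)
    (Span-generator {Q = NonStandard} {F = I-basis} {a = a} (inj₂ divides))

  module _ (b : Monomial n) (T : Subset n) (top : Top b T) (size : n ∸ k < ∣ T ∣)
           (i : Fin n) (k≤ai : k ≤ lookup (b · squarefree T) i) where

    private
      exponent : lookup (b · squarefree T) i ≡ lookup b i + ind T i
      exponent = lookup-·-squarefree b T i

    power-with : ∀ {s} → ∣ s ∣ ≡ ∣ T ∣ × lookup s i ≡ true → PowerDivides n k (b · squarefree s)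
    power-with {s} (_ , e) = i , (begin
      k                                ≤⟨ k≤ai ⟩
      lookup (b · squarefree T) i      ≡⟨ exponent ⟩
      lookup b i + ind T i             ≤⟨ +-monoʳ-≤ (lookup b i) (ind≤1 T i) ⟩
      lookup b i + 1                   ≡⟨ cong (λ c → lookup b i + (if c then 1 else 0)) e ⟨
      lookup b i + ind s i             ≡⟨ lookup-·-squarefree b s i ⟨
      lookup (b · squarefree s) i      ∎)
      where open ≤-Reasoning

    power-without : lookup T i ≡ false → ∀ s → PowerDivides n k (b · squarefree s)
    power-without T∌i s = i , (begin
      k                                ≤⟨ k≤ai ⟩
      lookup (b · squarefree T) i      ≡⟨ exponent ⟩
      lookup b i + ind T i             ≡⟨ cong (λ c → lookup b i + (if c then 1 else 0)) T∌i ⟩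
      lookup b i + 0                   ≤⟨ +-monoʳ-≤ (lookup b i) z≤n ⟩
      lookup b i + ind s i             ≡⟨ lookup-·-squarefree b s i ⟨
      lookup (b · squarefree s) i      ∎)
      where open ≤-Reasoning

    -- Since `i` lies in `T`, the leading term is not among the terms without `i`, which therefore
    -- have smaller rank. Their sum is in `E-span` by `omitted∈E-span`, and `Span-lower` bounds the
    -- indices that it uses.
    omitted-lower : 1 ≤ k → lookup T i ≡ true →
      Span (λ a → ElementaryLead n k a × rank a < rank (b · squarefree T)) E-basis (terms b (has i false ∣ T ∣))
    omitted-lower 1≤k T∋i = Span-lower rank E-basis-leads (rank (b · squarefree T)) (terms b (has i false ∣ T ∣))
      (omitted∈E-span (pred k) b i ∣ T ∣ pred-k≤b n≤ size)
      (Allₚ.map⁺ (All.map (λ {s} (e , s∌i) → rank-maximal {S = s} top e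
        λ s≡T → contradiction (trans (sym T∋i) (trans (cong (λ t → lookup t i) (sym s≡T)) s∌i)) λ ())
        (has-all i false ∣ T ∣)))
      where
      pred-k≤b : pred k ≤ lookup b i
      pred-k≤b = pred-mono-≤ (≤-trans k≤ai (≤-reflexive (trans exponent
        (trans (cong (λ c → lookup b i + (if c then 1 else 0)) T∋i) (+-comm (lookup b i) 1)))))
      -- Because ∣T∣ ≥ n - k + 1, the k - 1 available factors xᵢ suffice to raise the degree from
      -- ∣T∣ to `n`.
      n≤ : n ≤ pred k + ∣ T ∣
      n≤ = begin
        n                      ≤⟨ m≤n+m∸n n k ⟩
        k + (n ∸ k)            ≡⟨ cong (_+ (n ∸ k)) (suc-pred k {{>-nonZero 1≤k}}) ⟨
        suc (pred k) + (n ∸ k) ≡⟨ +-suc (pred k) (n ∸ k) ⟨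
        pred k + suc (n ∸ k)   ≤⟨ +-monoʳ-≤ (pred k) size ⟩
        pred k + ∣ T ∣         ∎
        where open ≤-Reasoning

  -- Only a displaced element needs work. Its terms containing `i` are multiples of xᵢᵏ; the others
  -- are multiples too if `i` is outside `T`, and otherwise combine elements of smaller rank, to
  -- which the induction applies.
  E-basis∈I-span : 1 ≤ k → ∀ {a} → ElementaryLead n k a → Acc _<_ (rank a) → E-basis a ∈ I-span
  E-basis∈I-span 1≤k {a} lead (acc rec) = case powerDivides? k a of λ
    { (no ¬power)       → subst (_∈ I-span) (I-basis-¬power ¬power)
        (Span-generator {Q = NonStandard} {F = I-basis} {a = a} (inj₁ lead))
    ; (yes (i , k≤ai)) → divisible i k≤ai (E-basis-lead lead) }
    where
    divisible : ∀ i → k ≤ lookup a i →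
      (∃₂ λ b T → Top b T × n ∸ k < ∣ T ∣ × a ≡ b · squarefree T × E-basis a ≡ terms b (ofSize n ∣ T ∣)) →
      E-basis a ∈ I-span
    divisible i k≤ai (b , T , top , size , refl , basis≡) =
      subst (_∈ I-span) (sym basis≡) (V.closed-≋ {f = u +ₚ v} {terms b (ofSize n ∣ T ∣)}
        (λ g → sym (terms-split b i ∣ T ∣ g))
        (V.closed-+ {u} {v}
          (V.closed-terms {u} (Allₚ.map⁺ (All.map (λ {s} e → power∈I-span (power-with b T top size i k≤ai {s} e))
            (has-all i true ∣ T ∣))))
          (without (lookup T i) refl)))
      where
      u v : Polynomial n
      u = terms b (has i true ∣ T ∣)
      v = terms b (has i false ∣ T ∣)

      without : ∀ e → lookup T i ≡ e → v ∈ I-span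
      without false T∌i = V.closed-terms {v} (Allₚ.map⁺ (All.universal
        (λ s → power∈I-span (power-without b T top size i k≤ai T∌i s)) (has i false ∣ T ∣)))
      without true  T∋i = Span-mono {F = E-basis} {V = I-span} Span-isSubspace
        (λ (lead , lower) → E-basis∈I-span 1≤k lead (rec lower))
        (omitted-lower b T top size i k≤ai 1≤k T∋i)

  module _ (1≤k : 1 ≤ k) where

    E-span⊆I-span : E-span ⊆ I-span
    E-span⊆I-span = Span-mono {F = E-basis} {V = I-span} Span-isSubspace
      (λ lead → E-basis∈I-span 1≤k lead (<-wellFounded _))

    -- `I-span` is not visibly closed under multiplication. Carrying an arbitrary monomial factor
    -- `w` through the induction lets the case `multiply` absorb the terms of `h` into it.
    I⊆I-span-shifted : ∀ {f} → f ∈ I n k → ∀ w → monomial w *ₚ f ∈ I-span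
    I⊆I-span-shifted (generator (power i)) w = power∈I-span (i , lookup-power w i k)
    I⊆I-span-shifted (generator (elem d n∸k<d _)) w = V.closed-≋ {f = terms w (ofSize n d)}
      (λ g → sym (monomial-*-elementary w d g)) (E-span⊆I-span (terms∈E-span w d n∸k<d))
    I⊆I-span-shifted zero w = V.has-0
    I⊆I-span-shifted (add {f} {h} p q) w = V.closed-≋ {f = monomial w *ₚ f +ₚ monomial w *ₚ h}
      (λ g → begin
        eval g (monomial w *ₚ f +ₚ monomial w *ₚ h)            ≡⟨ eval-+ g (monomial w *ₚ f) (monomial w *ₚ h) ⟩
        eval g (monomial w *ₚ f) ℚ.+ eval g (monomial w *ₚ h)  ≡⟨ cong₂ ℚ._+_ (eval-shift g w f) (eval-shift g w h) ⟩
        eval (λ v → g (w · v)) f ℚ.+ eval (λ v → g (w · v)) h  ≡⟨ eval-+ (λ v → g (w · v)) f h ⟨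
        eval (λ v → g (w · v)) (f +ₚ h)                        ≡⟨ eval-shift g w (f +ₚ h) ⟨
        eval g (monomial w *ₚ (f +ₚ h))                        ∎)
      (V.closed-+ (I⊆I-span-shifted p w) (I⊆I-span-shifted q w))
      where open ≡-Reasoning
    I⊆I-span-shifted (multiply h {f} p) w = V.closed-≋ {f = bind (λ u → monomial (w · u) *ₚ f) h}
      (λ g → begin
        eval g (bind (λ u → monomial (w · u) *ₚ f) h)          ≡⟨ eval-bind g (λ u → monomial (w · u) *ₚ f) h ⟩
        eval (λ u → eval g (monomial (w · u) *ₚ f)) h          ≡⟨ eval-cong h (λ u → trans (eval-shift g (w · u) f)
                                                                    (eval-cong f (λ v → cong g (·-assoc w u v)))) ⟩
        eval (λ u → eval (λ v → g (w · (u · v))) f) h          ≡⟨ eval-* (λ v → g (w · v)) h f ⟨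
        eval (λ v → g (w · v)) (h *ₚ f)                        ≡⟨ eval-shift g w (h *ₚ f) ⟨
        eval g (monomial w *ₚ (h *ₚ f))                        ∎)
      (V.closed-bind (λ u → monomial (w · u) *ₚ f) {h} (All.universal (λ (_ , u) → I⊆I-span-shifted p (w · u)) h))
      where open ≡-Reasoning
    I⊆I-span-shifted (respects {f} {h} f≈h p) w = V.closed-≋ {f = monomial w *ₚ f}
      (λ g → trans (eval-shift g w f) (trans (≈ₚ⇒≋ f h f≈h (λ v → g (w · v))) (sym (eval-shift g w h))))
      (I⊆I-span-shifted p w)

    I⊆I-span : I n k ⊆ I-span
    I⊆I-span {f} p = V.closed-≋ {f = monomial 1ᵐ *ₚ f}
      (λ g → trans (eval-shift g 1ᵐ f) (eval-cong f (λ v → cong g (1ᵐ-identityˡ v))))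
      (I⊆I-span-shifted p 1ᵐ)

-- The basis of the quotient.

coeff-unique : ∀ (ts : Polynomial n) → Unique (List.map proj₂ ts) →
               All (λ (_ , a) → coeff ts a ≡ 0ℚ) ts → All (λ (c , _) → c ≡ 0ℚ) ts
coeff-unique []             []               []       = []
coeff-unique ((c , a) ∷ ts) (a∉ts ∷ unique) (z ∷ zs) = c≡0 ∷ coeff-unique ts unique
  (All.zipWith (λ { {_ , b} (z , a≢b) → trans (sym (trans (cong (ℚ._+ coeff ts b)
      (cong (if_then c else 0ℚ) (dec-no a b a≢b))) (ℚₚ.+-identityˡ _))) z }) (zs , Allₚ.map⁻ a∉ts))
  where
  dec-no : ∀ (a b : Monomial _) → a ≢ b → does (a ≟ᵐ b) ≡ false
  dec-no a b a≢b with a ≟ᵐ b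
  ... | yes a≡b = contradiction a≡b a≢b
  ... | no  _   = refl
  c≡0 : c ≡ 0ℚ
  c≡0 with a ≟ᵐ a
  ... | no a≢a = contradiction refl a≢a
  ... | yes _  = trans (sym (trans (cong (c ℚ.+_) (coeff-off-support ts a
      (All.map (λ a≢b b≡a → a≢b (sym b≡a)) (Allₚ.map⁻ a∉ts)))) (ℚₚ.+-identityʳ c))) z

module _ {n k : ℕ} (1≤k : 1 ≤ k) (k≤n : k ≤ n) where

  GS⇒standard : ∀ {a} → GS n k a → ¬ NonStandard n k a
  GS⇒standard gs (inj₁ lead)    = GS⇒¬ElementaryLead _ gs lead
  GS⇒standard gs (inj₂ divides) = GS⇒¬PowerDivides _ gs divides

  I-basis-GS : ∀ {a} → GS n k a → I-basis n k a ≡ monomial a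
  I-basis-GS {a} gs = trans (I-basis-¬power n k (GS⇒standard gs ∘ inj₂))
                            (E-basis-¬lead n k (GS⇒standard gs ∘ inj₁))

  eval-linearCombination : ∀ g ts →
    eval g (linearCombination (R n k) (GS n k) monomial ts) ≡ eval g ts
  eval-linearCombination g ts = trans (eval-bind g monomial ts) (eval-cong ts (eval-monomial g))

  eval-standard : ∀ g ts → All (GS n k ∘ proj₂) ts →
                  eval (λ a → eval g (I-basis n k a)) ts ≡ eval g ts
  eval-standard g []             []       = refl
  eval-standard g ((c , a) ∷ ts) (p ∷ ps) = cong₂ (λ q r → c ℚ.* q ℚ.+ r)
    (trans (cong (eval g) (I-basis-GS p)) (eval-monomial g a)) (eval-standard g ts ps)

  -- On Garsia-Stanton indices the family `I-basis` consists of the monomials themselves, so `ts`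
  -- has two expansions in it, one with standard and one with nonstandard indices. By `triangular`
  -- their difference has zero coefficients.
  standard∩I-span : ∀ ts → All (GS n k ∘ proj₂) ts → I-span n k ts →
                    ∀ {a} → GS n k a → coeff ts a ≡ 0ℚ
  standard∩I-span ts standard (combination ss nonstandard e) {a} a∈GS = begin
    coeff ts a
      ≡⟨ solve 1 (λ q → q := q :+ con (ℚ.- 1ℚ) :* con 0ℚ) refl (coeff ts a) ⟩
    coeff ts a ℚ.+ (ℚ.- 1ℚ) ℚ.* 0ℚ
      ≡⟨ cong (λ q → coeff ts a ℚ.+ (ℚ.- 1ℚ) ℚ.* q) (coeff-off-support ss a
           (All.map (λ { q refl → GS⇒standard a∈GS q }) nonstandard)) ⟨
    coeff ts a ℚ.+ (ℚ.- 1ℚ) ℚ.* coeff ss a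
      ≡⟨ coeff-- ts ss a ⟨
    coeff d a
      ≡⟨ triangular rank (I-basis-leads n k) 0 d (λ u _ → ≋⇒≈ₚ (bind (I-basis n k) d) 0ₚ vanish u) a z≤n ⟩
    0ℚ ∎
    where
    open ≡-Reasoning
    open +-*-Solver
    d = ts +ₚ -ₚ ss
    φ : (Monomial n → ℚ) → Monomial n → ℚ
    φ g a = eval g (I-basis n k a)

    vanish : bind (I-basis n k) d ≋ 0ₚ
    vanish g = begin
      eval g (bind (I-basis n k) d)
        ≡⟨ eval-bind g (I-basis n k) d ⟩
      eval (φ g) d
        ≡⟨ eval-+ (φ g) ts (-ₚ ss) ⟩
      eval (φ g) ts ℚ.+ eval (φ g) (-ₚ ss)
        ≡⟨ cong₂ ℚ._+_ (eval-standard g ts standard) (eval-• (φ g) (ℚ.- 1ℚ) ss) ⟩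
      eval g ts ℚ.+ (ℚ.- 1ℚ) ℚ.* eval (φ g) ss
        ≡⟨ cong (λ q → eval g ts ℚ.+ (ℚ.- 1ℚ) ℚ.* q) (trans (e g) (eval-bind g (I-basis n k) ss)) ⟨
      eval g ts ℚ.+ (ℚ.- 1ℚ) ℚ.* eval g ts
        ≡⟨ solve 1 (λ q → q :+ con (ℚ.- 1ℚ) :* q := con 0ℚ) refl (eval g ts) ⟩
      0ℚ ∎

  independent : LinearlyIndependent (R n k) (GS n k) monomial
  independent ts standard unique lc≈0 =
    coeff-unique ts unique (All.map (standard∩I-span ts standard ts∈I-span) standard)
    where
    lc = linearCombination (R n k) (GS n k) monomial ts
    ts∈I-span : I-span n k ts
    ts∈I-span = IsSubspace.closed-≋ Span-isSubspace {f = lc +ₚ -ₚ 0ₚ} {ts}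
      (λ g → trans (eval-+ g lc (-ₚ 0ₚ)) (trans (ℚₚ.+-identityʳ (eval g lc)) (eval-linearCombination g ts)))
      (I⊆I-span n k 1≤k lc≈0)

  open Quotient (Generator n k) using (_≈_; ≈ₚ⇒≈; ≈-trans; +-cong; •-cong; scale)

  -- A polynomial with Garsia-Stanton terms is its own coefficient list, so `linearCombination`
  -- enters only in `spanning`.
  Spanned : Pred (Polynomial n) 0ℓ
  Spanned f = ∃ λ ts → All (GS n k ∘ proj₂) ts × ts ≈ f

  Spanned-isSubspace : IsSubspace Spanned
  Spanned-isSubspace = record
    { has-0    = [] , [] , zero
    ; closed-+ = λ { {f} {h} (ts , p , e) (ts′ , p′ , e′) →
        ts +ₚ ts′ , Allₚ.++⁺ p p′ , +-cong {ts} {f} {ts′} {h} e e′ }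
    ; closed-• = λ { c {f} (ts , p , e) → c • ts , Allₚ.map⁺ p , •-cong c {ts} {f} e }
    ; closed-≋ = λ { {f} {h} f≋h (ts , p , e) →
        ts , p , ≈-trans {ts} {f} {h} e (≈ₚ⇒≈ f h (≋⇒≈ₚ f h f≋h)) }
    }

  I⊆Spanned : I n k ⊆ Spanned
  I⊆Spanned f∈I = [] , [] , scale (ℚ.- 1ℚ) f∈I

  -- Straightening by induction on the rank: modulo I, a leading monomial of E is minus the sum of
  -- the other terms of its product, all of smaller rank.
  monomial-spanned : ∀ a → Acc _<_ (rank a) → monomial a ∈ Spanned
  monomial-spanned a (acc rec) = case elementaryLead n k a of λ
    { (yes lead) → from-lead lead
    ; (no ¬lead) → case powerDivides? k a of λ
      { (yes (i , k≤ai)) → from-power i (factor-power a i k k≤ai)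
      ; (no  ¬power)     → monomial a
          , sorted⇒GS 1≤k k≤n a (proj₁ (sort a)) (proj₂ (sort a)) ¬lead ¬power ∷ []
          , ≈ₚ⇒≈ (monomial a) (monomial a) (λ _ → refl) } }
    where
    open IsSubspace Spanned-isSubspace

    from-power : ∀ i → (∃ λ c → a ≡ c · (x i ^ k) × lookup a i ≡ lookup c i + k) → monomial a ∈ Spanned
    from-power i (c , refl , _) = I⊆Spanned (multiply (monomial c) (generator (power i)))

    from-lead : ElementaryLead n k a → monomial a ∈ Spanned
    from-lead (b , T , top , size , refl) =
      closed-∸ Spanned-isSubspace (monomial (b · squarefree T)) (terms b (others T))
        (closed-≋ {f = u} {monomial (b · squarefree T) +ₚ terms b (others T)} (terms-extract b T) (I⊆Spanned u∈I))
        (closed-terms {terms b (others T)} (Allₚ.map⁺ (All.map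
          (λ {s} (e , ne) → monomial-spanned (b · squarefree s) (rec (rank-maximal top e ne))) (others-all T))))
      where
      u = terms b (ofSize n ∣ T ∣)
      u∈I : u ∈ I n k
      u∈I = respects (≋⇒≈ₚ (monomial b *ₚ elementary n ∣ T ∣) u (monomial-*-elementary b ∣ T ∣))
        (multiply (monomial b) (generator (elem ∣ T ∣ size (Subsetₚ.∣p∣≤n T))))

  spanning : Spanning (R n k) (GS n k) monomial
  spanning f = combine (IsSubspace.closed-terms Spanned-isSubspace {f}
    (All.universal (λ (_ , u) → monomial-spanned u (<-wellFounded (rank u))) f))
    where
    combine : Spanned f → ∃ λ ts → All (GS n k ∘ proj₂) ts ×
              linearCombination (R n k) (GS n k) monomial ts ≈ f
    combine (ts , standard , ts≈f) = ts , standard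
      , ≈-trans {lc} {ts} {f} (≈ₚ⇒≈ lc ts (≋⇒≈ₚ lc ts λ g → eval-linearCombination g ts)) ts≈f
      where lc = linearCombination (R n k) (GS n k) monomial ts

theorem5p3 : (n k : ℕ) → 1 ≤ k → k ≤ n → IsBasis (R n k) (GS n k) monomial
theorem5p3 n k 1≤k k≤n = independent 1≤k k≤n , spanning 1≤k k≤n
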